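{- The functor $\Gamma_{\mathbb Q}:\mathbf{uQVL}\to\mathbf{DMV}$ defined on objects by $\Gamma_{\mathbb Q}(V,u)=[0,u]_V$ and on arrows $f:(V,u)\to(W,w)$ by $\Gamma_{\mathbb Q}(f)=f|_{[0,u]_V}$ establishes a categorical equivalence between $\mathbf{uQVL}$ and $\mathbf{DMV}$.
   Context: An MV-algebra is a structure $(A,\oplus,{}^*,0)$ such that $(A,\oplus,0)$ is an Abelian monoid, $(x^*)^*=x$, $(x^*\oplus y)^*\oplus y=(y^*\oplus x)^*\oplus x$ and $0^*\oplus x=0^*$; $x\odot y=(x^*\oplus y^*)^*$, and $mx$ is the $m$-fold $\oplus$-sum of $x$. A DMV-algebra is an MV-algebra $A$ with unary operators $\{\delta_n\}_{n\ge1}$ satisfying $n\delta_nx=x$ and $\delta_nx\odot(n-1)\delta_nx=0$ for all $x\in A$, $n\ge1$. $\mathbf{DMV}$ is the category of DMV-algebras with homomorphisms of DMV-algebras (maps preserving $\oplus,{}^*,0$ and all $\delta_n$). $\mathbf{uQVL}$ is the category whose objects are pairs $(V,u)$, where $V$ is a $\mathbb Q$-vector lattice (a lattice-ordered linear space over $\mathbb Q$) and $u\in V$ is a strong unit ($u\ge 0$ and for each $v\in V$ there is $n\in\mathbb N$ with $|v|\le nu$), and whose arrows are the linear maps over $\mathbb Q$ preserving the lattice operations and the strong unit. For $(V,u)$ in $\mathbf{uQVL}$, $[0,u]_V$ is the set $\{x\in V\mid 0\le x\le u\}$ with $x\oplus y=u\wedge(x+y)$, $x^*=u-x$, and the scalar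 multiplication of $V$ by rationals in $[0,1]$; as a DMV-algebra, $\delta_n(x)=\frac1nx$. -}

module Defs where

open import Algebra.Bundles using (CommutativeMonoid; Ring)
open import Algebra.Definitions using (Congruent₁; Involutive; LeftZero)
open import Algebra.Module.Bundles using (LeftModule)
import Algebra.Module.Morphism.Construct.Composition as ModuleComposition
import Algebra.Module.Morphism.Construct.Identity as ModuleIdentity
open import Algebra.Module.Morphism.Structures using (IsLeftModuleHomomorphism)
import Algebra.Morphism.Construct.Composition as Composition
import Algebra.Morphism.Construct.Identity as Identity
open import Algebra.Morphism.Definitions using (Homomorphic₁; Homomorphic₂)
open import Algebra.Morphism.Structures using (IsMonoidHomomorphism)
import Algebra.Definitions.RawMonoid as RawMult
import Algebra.Properties.AbelianGroup as AbelianGroupProperties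
open import Data.Integer.Base as ℤ using (+_)
import Data.Integer.Properties as ℤ
open import Data.Nat.Base as ℕ using (ℕ; zero; suc; NonZero; z≤n; s≤s)
import Data.Nat.Properties as ℕ
open import Data.Product.Base using (∃; _×_; _,_)
open import Data.Rational.Base as ℚ using (ℚ; 0ℚ; 1ℚ; _/_; toℚᵘ)
import Data.Rational.Properties as ℚ
open import Data.Rational.Unnormalised.Base as ℚᵘ using (mkℚᵘ)
import Data.Rational.Unnormalised.Properties as ℚᵘ
open import Level using (Level; _⊔_) renaming (suc to lsuc)
open import Relation.Binary.Core using (Rel)
open import Relation.Binary.Lattice using (IsLattice; Lattice)
import Relation.Binary.Lattice.Properties.JoinSemilattice as JoinProperties
import Relation.Binary.Lattice.Properties.MeetSemilattice as MeetProperties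
import Relation.Binary.Reasoning.PartialOrder as PosetReasoning
import Relation.Binary.Reasoning.Setoid as SetoidReasoning
open import Relation.Binary.PropositionalEquality.Core as ≡ using (_≡_)
open import Relation.Binary.Structures using (IsEquivalence)

-- All sets are setoids: algebras carry their own equality, arrows respect it
-- and are compared pointwise. Hence hom-sets carry an equality too.

record Category (o h e : Level) : Set (lsuc (o ⊔ h ⊔ e)) where
  infix  4 _≈_ _⇒_
  infixr 9 _∘_
  field
    Obj       : Set o
    _⇒_       : Obj → Obj → Set h
    _≈_       : ∀ {A B} → Rel (A ⇒ B) e
    id        : ∀ {A} → A ⇒ A
    _∘_       : ∀ {A B C} → B ⇒ C → A ⇒ B → A ⇒ C
    equiv     : ∀ {A B} → IsEquivalence (_≈_ {A} {B})
    ∘-resp-≈  : ∀ {A B C} {f f′ : B ⇒ C} {g g′ : A ⇒ B} →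
                f ≈ f′ → g ≈ g′ → f ∘ g ≈ f′ ∘ g′
    identityˡ : ∀ {A B} {f : A ⇒ B} → id ∘ f ≈ f
    identityʳ : ∀ {A B} {f : A ⇒ B} → f ∘ id ≈ f
    assoc     : ∀ {A B C D} {f : A ⇒ B} {g : B ⇒ C} {h : C ⇒ D} →
                (h ∘ g) ∘ f ≈ h ∘ (g ∘ f)

record Functor {o h e o′ h′ e′ : Level}
               (C : Category o h e) (D : Category o′ h′ e′)
               : Set (o ⊔ h ⊔ e ⊔ o′ ⊔ h′ ⊔ e′) where
  private
    module C = Category C
    module D = Category D
  field
    F₀           : C.Obj → D.Obj
    F₁           : ∀ {A B} → A C.⇒ B → F₀ A D.⇒ F₀ B
    F-resp-≈     : ∀ {A B} {f g : A C.⇒ B} → f C.≈ g → F₁ f D.≈ F₁ g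
    identity     : ∀ {A} → F₁ (C.id {A}) D.≈ D.id
    homomorphism : ∀ {X Y Z} {f : X C.⇒ Y} {g : Y C.⇒ Z} →
                   F₁ (g C.∘ f) D.≈ F₁ g D.∘ F₁ f

module _ {o h e : Level} {C : Category o h e} where
  open Category C

  idF : Functor C C
  idF = record
    { F₀           = λ A → A
    ; F₁           = λ f → f
    ; F-resp-≈     = λ f≈g → f≈g
    ; identity     = IsEquivalence.refl equiv
    ; homomorphism = IsEquivalence.refl equiv
    }

module _ {o h e o′ h′ e′ o″ h″ e″ : Level}
         {C : Category o h e} {D : Category o′ h′ e′} {E : Category o″ h″ e″} where
  private module E = Category E

  infixr 9 _∘F_
  _∘F_ : Functor D E → Functor C D → Functor C E
  G ∘F F = record
    { F₀           = λ A → G.F₀ (F.F₀ A)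
    ; F₁           = λ f → G.F₁ (F.F₁ f)
    ; F-resp-≈     = λ f≈g → G.F-resp-≈ (F.F-resp-≈ f≈g)
    ; identity     = IsEquivalence.trans E.equiv (G.F-resp-≈ F.identity) G.identity
    ; homomorphism = IsEquivalence.trans E.equiv (G.F-resp-≈ F.homomorphism) G.homomorphism
    }
    where
    module F = Functor F
    module G = Functor G

record NaturalIsomorphism {o h e o′ h′ e′ : Level}
                          {C : Category o h e} {D : Category o′ h′ e′}
                          (F G : Functor C D)
                          : Set (o ⊔ h ⊔ h′ ⊔ e′) where
  private
    module C = Category C
    module F = Functor F
    module G = Functor G
  open Category D
  field
    η       : ∀ A → F.F₀ A ⇒ G.F₀ A
    η⁻¹     : ∀ A → G.F₀ A ⇒ F.F₀ A
    natural : ∀ {A B} (f : A C.⇒ B) → η B ∘ F.F₁ f ≈ G.F₁ f ∘ η A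
    isoˡ    : ∀ A → η⁻¹ A ∘ η A ≈ id
    isoʳ    : ∀ A → η A ∘ η⁻¹ A ≈ id

record IsCategoricalEquivalence {o h e o′ h′ e′ : Level}
                                {C : Category o h e} {D : Category o′ h′ e′}
                                (F : Functor C D)
                                : Set (o ⊔ h ⊔ e ⊔ o′ ⊔ h′ ⊔ e′) where
  field
    F⁻¹    : Functor D C
    unit   : NaturalIsomorphism idF (F⁻¹ ∘F F)
    counit : NaturalIsomorphism (F ∘F F⁻¹) idF

record MVAlgebra (c ℓ : Level) : Set (lsuc (c ⊔ ℓ)) where
  infix 8 _*
  field
    commutativeMonoid : CommutativeMonoid c ℓ

  open CommutativeMonoid commutativeMonoid public
    renaming (_∙_ to _⊕_; ε to 0#; ∙-cong to ⊕-cong)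

  field
    _*           : Carrier → Carrier
    *-cong       : Congruent₁ _≈_ _*
    *-involutive : Involutive _≈_ _*
    łukasiewicz  : ∀ x y → ((x * ⊕ y) * ⊕ y) ≈ ((y * ⊕ x) * ⊕ x)
    0*-zeroˡ     : LeftZero _≈_ (0# *) _⊕_

  infixl 7 _⊙_
  _⊙_ : Carrier → Carrier → Carrier
  x ⊙ y = (x * ⊕ y *) *

  infixr 8 _·_
  _·_ : ℕ → Carrier → Carrier
  _·_ = RawMult._×_ rawMonoid

record DMVAlgebra (c ℓ : Level) : Set (lsuc (c ⊔ ℓ)) where
  field
    mvAlgebra : MVAlgebra c ℓ

  open MVAlgebra mvAlgebra public

  field
    δ      : (n : ℕ) .{{_ : NonZero n}} → Carrier → Carrier
    δ-cong : ∀ n .{{_ : NonZero n}} → Congruent₁ _≈_ (δ n)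
    ·-δ    : ∀ n .{{_ : NonZero n}} x → n · δ n x ≈ x
    δ-⊙    : ∀ n .{{_ : NonZero n}} x → δ n x ⊙ ((n ℕ.∸ 1) · δ n x) ≈ 0#

module _ {c ℓ c′ ℓ′ : Level} (A : DMVAlgebra c ℓ) (B : DMVAlgebra c′ ℓ′) where
  private
    module A = DMVAlgebra A
    module B = DMVAlgebra B

  record DMVHomomorphism : Set (c ⊔ ℓ ⊔ c′ ⊔ ℓ′) where
    field
      ⟦_⟧                   : A.Carrier → B.Carrier
      ⊕-isMonoidHomomorphism : IsMonoidHomomorphism A.rawMonoid B.rawMonoid ⟦_⟧
      *-homo                : Homomorphic₁ A.Carrier B.Carrier B._≈_ ⟦_⟧ A._* B._*
      δ-homo                : ∀ n .{{_ : NonZero n}} →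
                              Homomorphic₁ A.Carrier B.Carrier B._≈_ ⟦_⟧ (A.δ n) (B.δ n)

    open IsMonoidHomomorphism ⊕-isMonoidHomomorphism public
      using (⟦⟧-cong) renaming (homo to ⊕-homo; ε-homo to 0-homo)

DMV : (c ℓ : Level) → Category (lsuc (c ⊔ ℓ)) (c ⊔ ℓ) (c ⊔ ℓ)
DMV c ℓ = record
  { Obj       = DMVAlgebra c ℓ
  ; _⇒_       = DMVHomomorphism
  ; _≈_       = λ {A} {B} f g → ∀ x → DMVAlgebra._≈_ B (⟦ f ⟧ x) (⟦ g ⟧ x)
  ; id        = λ {A} → let open DMVAlgebra A in record
    { ⟦_⟧                    = λ x → x
    ; ⊕-isMonoidHomomorphism = Identity.isMonoidHomomorphism rawMonoid refl
    ; *-homo                 = λ _ → refl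
    ; δ-homo                 = λ _ _ → refl
    }
  ; _∘_       = λ {A} {B} {C} g f →
    let open DMVAlgebra C
        module f = DMVHomomorphism f
        module g = DMVHomomorphism g
    in record
    { ⟦_⟧                    = λ x → ⟦ g ⟧ (⟦ f ⟧ x)
    ; ⊕-isMonoidHomomorphism =
        Composition.isMonoidHomomorphism trans f.⊕-isMonoidHomomorphism g.⊕-isMonoidHomomorphism
    ; *-homo                 = λ x → trans (g.⟦⟧-cong (f.*-homo x)) (g.*-homo _)
    ; δ-homo                 = λ n x → trans (g.⟦⟧-cong (f.δ-homo n x)) (g.δ-homo n _)
    }
  ; equiv     = λ {A} {B} → let open DMVAlgebra B in record
    { refl  = λ _ → refl
    ; sym   = λ f≈g x → sym (f≈g x)
    ; trans = λ f≈g g≈h x → trans (f≈g x) (g≈h x)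
    }
  ; ∘-resp-≈  = λ {A} {B} {C} {f} {f′} {g} {g′} f≈f′ g≈g′ x →
    DMVAlgebra.trans C (DMVHomomorphism.⟦⟧-cong f (g≈g′ x)) (f≈f′ (⟦ g′ ⟧ x))
  ; identityˡ = λ {A} {B} _ → DMVAlgebra.refl B
  ; identityʳ = λ {A} {B} _ → DMVAlgebra.refl B
  ; assoc     = λ {A} {B} {C} {D} _ → DMVAlgebra.refl D
  }
  where open DMVHomomorphism using (⟦_⟧)

record QVectorLattice (c ℓ : Level) : Set (lsuc (c ⊔ ℓ)) where
  infix  4 _≤_
  infixr 7 _∧_
  infixr 6 _∨_
  infixl 6 _-ᴹ_
  -- ℚ being a commutative field, a left ℚ-module is a ℚ-vector space.
  field
    leftModule : LeftModule ℚ.+-*-ring c ℓ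

  open LeftModule leftModule public

  field
    _≤_         : Rel Carrierᴹ ℓ
    _∨_         : Carrierᴹ → Carrierᴹ → Carrierᴹ
    _∧_         : Carrierᴹ → Carrierᴹ → Carrierᴹ
    isLattice   : IsLattice _≈ᴹ_ _≤_ _∨_ _∧_
    +ᴹ-monoˡ-≤  : ∀ z {x y} → x ≤ y → x +ᴹ z ≤ y +ᴹ z
    *ₗ-monoʳ-≤  : ∀ {q} → 0ℚ ℚ.≤ q → ∀ {x y} → x ≤ y → q *ₗ x ≤ q *ₗ y

  _-ᴹ_ : Carrierᴹ → Carrierᴹ → Carrierᴹ
  x -ᴹ y = x +ᴹ (-ᴹ y)

  ∣_∣ : Carrierᴹ → Carrierᴹ
  ∣ v ∣ = v ∨ (-ᴹ v)

  infixr 8 _·ᴹ_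
  _·ᴹ_ : ℕ → Carrierᴹ → Carrierᴹ
  _·ᴹ_ = RawMult._×_ +ᴹ-rawMonoid

  IsStrongUnit : Carrierᴹ → Set (c ⊔ ℓ)
  IsStrongUnit u = 0ᴹ ≤ u × (∀ v → ∃ λ n → ∣ v ∣ ≤ n ·ᴹ u)

record UnitalQVectorLattice (c ℓ : Level) : Set (lsuc (c ⊔ ℓ)) where
  field
    vectorLattice : QVectorLattice c ℓ

  open QVectorLattice vectorLattice public

  field
    u            : Carrierᴹ
    isStrongUnit : IsStrongUnit u

module _ {c ℓ c′ ℓ′ : Level}
         (V : UnitalQVectorLattice c ℓ) (W : UnitalQVectorLattice c′ ℓ′) where
  private
    module V = UnitalQVectorLattice V
    module W = UnitalQVectorLattice W

  record UnitalQVectorLatticeHomomorphism : Set (c ⊔ ℓ ⊔ c′ ⊔ ℓ′) where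
    field
      ⟦_⟧                      : V.Carrierᴹ → W.Carrierᴹ
      isLeftModuleHomomorphism : IsLeftModuleHomomorphism V.rawLeftModule W.rawLeftModule ⟦_⟧
      ∨-homo                   : Homomorphic₂ V.Carrierᴹ W.Carrierᴹ W._≈ᴹ_ ⟦_⟧ V._∨_ W._∨_
      ∧-homo                   : Homomorphic₂ V.Carrierᴹ W.Carrierᴹ W._≈ᴹ_ ⟦_⟧ V._∧_ W._∧_
      u-homo                   : ⟦ V.u ⟧ W.≈ᴹ W.u

    open IsLeftModuleHomomorphism isLeftModuleHomomorphism public
      using (⟦⟧-cong; +ᴹ-homo; 0ᴹ-homo; -ᴹ-homo; *ₗ-homo)

uQVL : (c ℓ : Level) → Category (lsuc (c ⊔ ℓ)) (c ⊔ ℓ) (c ⊔ ℓ)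
uQVL c ℓ = record
  { Obj       = UnitalQVectorLattice c ℓ
  ; _⇒_       = UnitalQVectorLatticeHomomorphism
  ; _≈_       = λ {V} {W} f g → ∀ x → UnitalQVectorLattice._≈ᴹ_ W (⟦ f ⟧ x) (⟦ g ⟧ x)
  ; id        = λ {V} → let open UnitalQVectorLattice V in record
    { ⟦_⟧                      = λ x → x
    ; isLeftModuleHomomorphism = ModuleIdentity.isLeftModuleHomomorphism rawLeftModule ≈ᴹ-refl
    ; ∨-homo                   = λ _ _ → ≈ᴹ-refl
    ; ∧-homo                   = λ _ _ → ≈ᴹ-refl
    ; u-homo                   = ≈ᴹ-refl
    }
  ; _∘_       = λ {U} {V} {W} g f →
    let open UnitalQVectorLattice W
        module f = UnitalQVectorLatticeHomomorphism f
        module g = UnitalQVectorLatticeHomomorphism g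
    in record
    { ⟦_⟧                      = λ x → ⟦ g ⟧ (⟦ f ⟧ x)
    ; isLeftModuleHomomorphism =
        ModuleComposition.isLeftModuleHomomorphism ≈ᴹ-trans
          f.isLeftModuleHomomorphism g.isLeftModuleHomomorphism
    ; ∨-homo                   = λ x y → ≈ᴹ-trans (g.⟦⟧-cong (f.∨-homo x y)) (g.∨-homo _ _)
    ; ∧-homo                   = λ x y → ≈ᴹ-trans (g.⟦⟧-cong (f.∧-homo x y)) (g.∧-homo _ _)
    ; u-homo                   = ≈ᴹ-trans (g.⟦⟧-cong f.u-homo) g.u-homo
    }
  ; equiv     = λ {V} {W} → let open UnitalQVectorLattice W in record
    { refl  = λ _ → ≈ᴹ-refl
    ; sym   = λ f≈g x → ≈ᴹ-sym (f≈g x)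
    ; trans = λ f≈g g≈h x → ≈ᴹ-trans (f≈g x) (g≈h x)
    }
  ; ∘-resp-≈  = λ {U} {V} {W} {f} {f′} {g} {g′} f≈f′ g≈g′ x →
    UnitalQVectorLattice.≈ᴹ-trans W
      (UnitalQVectorLatticeHomomorphism.⟦⟧-cong f (g≈g′ x)) (f≈f′ (⟦ g′ ⟧ x))
  ; identityˡ = λ {V} {W} _ → UnitalQVectorLattice.≈ᴹ-refl W
  ; identityʳ = λ {V} {W} _ → UnitalQVectorLattice.≈ᴹ-refl W
  ; assoc     = λ {T} {U} {V} {W} _ → UnitalQVectorLattice.≈ᴹ-refl W
  }
  where open UnitalQVectorLatticeHomomorphism using (⟦_⟧)

toℚᵘ-1/ : ∀ n → toℚᵘ (+ 1 / suc n) ℚᵘ.≃ mkℚᵘ (+ 1) n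
toℚᵘ-1/ n = ℚ.toℚᵘ-fromℚᵘ (mkℚᵘ (+ 1) n)

infixr 8 _·ℚ_
_·ℚ_ : ℕ → ℚ → ℚ
_·ℚ_ = RawMult._×_ (Ring.+-rawMonoid ℚ.+-*-ring)

toℚᵘ-·ℚ : ∀ k q → toℚᵘ (k ·ℚ q) ℚᵘ.≃ mkℚᵘ (+ k) 0 ℚᵘ.* toℚᵘ q
toℚᵘ-·ℚ zero    q = ℚᵘ.≃-sym (ℚᵘ.*-zeroˡ (toℚᵘ q))
toℚᵘ-·ℚ (suc k) q = begin
  toℚᵘ (q ℚ.+ k ·ℚ q)                             ≈⟨ ℚ.toℚᵘ-homo-+ q (k ·ℚ q) ⟩
  toℚᵘ q ℚᵘ.+ toℚᵘ (k ·ℚ q)                       ≈⟨ ℚᵘ.+-cong (ℚᵘ.≃-sym (ℚᵘ.*-identityˡ (toℚᵘ q))) (toℚᵘ-·ℚ k q) ⟩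
  ℚᵘ.1ℚᵘ ℚᵘ.* toℚᵘ q ℚᵘ.+ mkℚᵘ (+ k) 0 ℚᵘ.* toℚᵘ q ≈⟨ ℚᵘ.≃-sym (ℚᵘ.*-distribʳ-+ (toℚᵘ q) ℚᵘ.1ℚᵘ (mkℚᵘ (+ k) 0)) ⟩
  (ℚᵘ.1ℚᵘ ℚᵘ.+ mkℚᵘ (+ k) 0) ℚᵘ.* toℚᵘ q          ≈⟨ ℚᵘ.*-congʳ {toℚᵘ q} (ℚᵘ.≃-reflexive (≡.cong (λ m → mkℚᵘ (+ 1 ℤ.+ m) 0) (ℤ.*-identityʳ (+ k)))) ⟩
  mkℚᵘ (+ suc k) 0 ℚᵘ.* toℚᵘ q                    ∎
  where open SetoidReasoning ℚᵘ.≃-setoid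

0≤1/n : ∀ n .{{_ : NonZero n}} → 0ℚ ℚ.≤ + 1 / n
0≤1/n n = ℚ.nonNegative⁻¹ (+ 1 / n) {{ℚ.normalize-nonNeg 1 n}}

1/n≤1 : ∀ n .{{_ : NonZero n}} → + 1 / n ℚ.≤ 1ℚ
1/n≤1 (suc n) = ℚ.toℚᵘ-cancel-≤
  (ℚᵘ.≤-respˡ-≃ (ℚᵘ.≃-sym (toℚᵘ-1/ n)) (ℚᵘ.*≤* (ℤ.+≤+ (s≤s z≤n))))

n·1/n≡1 : ∀ n .{{_ : NonZero n}} → n ·ℚ (+ 1 / n) ≡ 1ℚ
n·1/n≡1 (suc n) = ℚ.toℚᵘ-injective (begin
  toℚᵘ (suc n ·ℚ (+ 1 / suc n))             ≈⟨ toℚᵘ-·ℚ (suc n) (+ 1 / suc n) ⟩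
  mkℚᵘ (+ suc n) 0 ℚᵘ.* toℚᵘ (+ 1 / suc n)  ≈⟨ ℚᵘ.*-congˡ {mkℚᵘ (+ suc n) 0} (toℚᵘ-1/ n) ⟩
  mkℚᵘ (+ suc n) 0 ℚᵘ.* mkℚᵘ (+ 1) n        ≈⟨ ℚᵘ.*≡* (≡.cong +_ eq) ⟩
  ℚᵘ.1ℚᵘ                                    ∎)
  where
  open SetoidReasoning ℚᵘ.≃-setoid
  eq : (suc n ℕ.* 1) ℕ.* 1 ≡ 1 ℕ.* (1 ℕ.* suc n)
  eq = ≡.trans (ℕ.*-identityʳ (suc n ℕ.* 1))
      (≡.trans (ℕ.*-comm (suc n) 1) (≡.sym (ℕ.*-identityˡ (1 ℕ.* suc n))))

module UnitInterval {c ℓ : Level} (V : UnitalQVectorLattice c ℓ) where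
  open UnitalQVectorLattice V

  record [0,u] : Set (c ⊔ ℓ) where
    constructor interval
    field
      val  : Carrierᴹ
      0≤   : 0ᴹ ≤ val
      ≤u   : val ≤ u

  open [0,u]

  lattice : Lattice c ℓ ℓ
  lattice = record { isLattice = isLattice }

  open Lattice lattice
    using (poset; antisym; x∧y≤x; x∧y≤y; ∧-greatest; x≤x∨y; y≤x∨y; ∨-least;
           meetSemilattice; joinSemilattice)
    renaming (refl to ≤-refl; trans to ≤-trans; reflexive to ≤-reflexive)
  open MeetProperties meetSemilattice using (∧-cong; ∧-monotonic)
  open JoinProperties joinSemilattice using (∨-comm)
  open AbelianGroupProperties +ᴹ-abelianGroup
    using (⁻¹-∙-comm; ⁻¹-involutive; ε⁻¹≈ε; xyx⁻¹≈y)
  module ≈-R = SetoidReasoning ≈ᴹ-setoid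
  module ≤-R = PosetReasoning poset

  ≤-≈-≈ : ∀ {x x′ y y′} → x ≈ᴹ x′ → y ≈ᴹ y′ → x ≤ y → x′ ≤ y′
  ≤-≈-≈ p q r = ≤-trans (≤-reflexive (≈ᴹ-sym p)) (≤-trans r (≤-reflexive q))

  +ᴹ-monoʳ-≤ : ∀ z {x y} → x ≤ y → z +ᴹ x ≤ z +ᴹ y
  +ᴹ-monoʳ-≤ z x≤y = ≤-≈-≈ (+ᴹ-comm _ _) (+ᴹ-comm _ _) (+ᴹ-monoˡ-≤ z x≤y)

  +ᴹ-mono-≤ : ∀ {x y z w} → x ≤ y → z ≤ w → x +ᴹ z ≤ y +ᴹ w
  +ᴹ-mono-≤ p q = ≤-trans (+ᴹ-monoˡ-≤ _ p) (+ᴹ-monoʳ-≤ _ q)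

  x-z+z≈x : ∀ x z → (x -ᴹ z) +ᴹ z ≈ᴹ x
  x-z+z≈x x z = begin
    (x +ᴹ -ᴹ z) +ᴹ z ≈⟨ +ᴹ-assoc x (-ᴹ z) z ⟩
    x +ᴹ (-ᴹ z +ᴹ z) ≈⟨ +ᴹ-congˡ (-ᴹ‿inverseˡ z) ⟩
    x +ᴹ 0ᴹ          ≈⟨ +ᴹ-identityʳ x ⟩
    x                ∎
    where open ≈-R

  x+z-z≈x : ∀ x z → (x +ᴹ z) -ᴹ z ≈ᴹ x
  x+z-z≈x x z = begin
    (x +ᴹ z) +ᴹ -ᴹ z ≈⟨ +ᴹ-assoc x z (-ᴹ z) ⟩
    x +ᴹ (z +ᴹ -ᴹ z) ≈⟨ +ᴹ-congˡ (-ᴹ‿inverseʳ z) ⟩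
    x +ᴹ 0ᴹ          ≈⟨ +ᴹ-identityʳ x ⟩
    x                ∎
    where open ≈-R

  +ᴹ-cancelʳ-≤ : ∀ z {x y} → x +ᴹ z ≤ y +ᴹ z → x ≤ y
  +ᴹ-cancelʳ-≤ z p = ≤-≈-≈ (x+z-z≈x _ z) (x+z-z≈x _ z) (+ᴹ-monoˡ-≤ (-ᴹ z) p)

  x≤y⇒0≤y-x : ∀ {x y} → x ≤ y → 0ᴹ ≤ y -ᴹ x
  x≤y⇒0≤y-x {x} p = ≤-≈-≈ (-ᴹ‿inverseʳ x) ≈ᴹ-refl (+ᴹ-monoˡ-≤ (-ᴹ x) p)

  x-[x-y]≈y : ∀ x y → x -ᴹ (x -ᴹ y) ≈ᴹ y
  x-[x-y]≈y x y = begin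
    x +ᴹ -ᴹ (x +ᴹ -ᴹ y)        ≈⟨ +ᴹ-congˡ (≈ᴹ-sym (⁻¹-∙-comm x (-ᴹ y))) ⟩
    x +ᴹ (-ᴹ x +ᴹ -ᴹ (-ᴹ y))   ≈⟨ +ᴹ-congˡ (+ᴹ-congˡ (⁻¹-involutive y)) ⟩
    x +ᴹ (-ᴹ x +ᴹ y)           ≈⟨ +ᴹ-congˡ (+ᴹ-comm (-ᴹ x) y) ⟩
    x +ᴹ (y +ᴹ -ᴹ x)           ≈⟨ ≈ᴹ-sym (+ᴹ-assoc x y (-ᴹ x)) ⟩
    (x +ᴹ y) +ᴹ -ᴹ x           ≈⟨ xyx⁻¹≈y x y ⟩
    y                          ∎
    where open ≈-R

  [x-z+y]+z≈x+y : ∀ x y z → ((x -ᴹ z) +ᴹ y) +ᴹ z ≈ᴹ x +ᴹ y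
  [x-z+y]+z≈x+y x y z = begin
    ((x -ᴹ z) +ᴹ y) +ᴹ z ≈⟨ +ᴹ-assoc (x -ᴹ z) y z ⟩
    (x -ᴹ z) +ᴹ (y +ᴹ z) ≈⟨ +ᴹ-congˡ (+ᴹ-comm y z) ⟩
    (x -ᴹ z) +ᴹ (z +ᴹ y) ≈⟨ ≈ᴹ-sym (+ᴹ-assoc (x -ᴹ z) z y) ⟩
    ((x -ᴹ z) +ᴹ z) +ᴹ y ≈⟨ +ᴹ-congʳ (x-z+z≈x x z) ⟩
    x +ᴹ y               ∎
    where open ≈-R

  ∧-+ᴹ : ∀ x y z → (x +ᴹ z) ∧ (y +ᴹ z) ≤ (x ∧ y) +ᴹ z
  ∧-+ᴹ x y z = ≤-≈-≈ (x-z+z≈x _ z) ≈ᴹ-refl (+ᴹ-monoˡ-≤ z (∧-greatest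
    (≤-≈-≈ ≈ᴹ-refl (x+z-z≈x x z) (+ᴹ-monoˡ-≤ (-ᴹ z) (x∧y≤x _ _)))
    (≤-≈-≈ ≈ᴹ-refl (x+z-z≈x y z) (+ᴹ-monoˡ-≤ (-ᴹ z) (x∧y≤y _ _)))))

  0≤u : 0ᴹ ≤ u
  0≤u = let p , _ = isStrongUnit in p

  x≤y⇒y∧x≈x : ∀ {x y} → x ≤ y → y ∧ x ≈ᴹ x
  x≤y⇒y∧x≈x p = antisym (x∧y≤y _ _) (∧-greatest p ≤-refl)

  -- Truncating a summand at u does not change a sum truncated at u.
  truncate-absorbs : ∀ s {z} → 0ᴹ ≤ z → u ∧ ((u ∧ s) +ᴹ z) ≈ᴹ u ∧ (s +ᴹ z)
  truncate-absorbs s {z} 0≤z = antisym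
    (∧-monotonic ≤-refl (+ᴹ-monoˡ-≤ z (x∧y≤y _ _)))
    (∧-greatest (x∧y≤x _ _) (≤-trans
      (∧-greatest
        (≤-trans (x∧y≤x _ _) (≤-≈-≈ (+ᴹ-identityʳ u) ≈ᴹ-refl (+ᴹ-monoʳ-≤ u 0≤z)))
        (x∧y≤y _ _))
      (∧-+ᴹ u s z)))

  infix  4 _≈_
  infixl 6 _⊕_
  infix  8 _*

  _≈_ : Rel [0,u] ℓ
  x ≈ y = val x ≈ᴹ val y

  _⊕_ : [0,u] → [0,u] → [0,u]
  x ⊕ y = record
    { val = u ∧ (val x +ᴹ val y)
    ; 0≤  = ∧-greatest 0≤u (≤-≈-≈ (+ᴹ-identityʳ 0ᴹ) ≈ᴹ-refl (+ᴹ-mono-≤ (0≤ x) (0≤ y)))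
    ; ≤u  = x∧y≤x _ _
    }

  _* : [0,u] → [0,u]
  x * = record
    { val = u -ᴹ val x
    ; 0≤  = x≤y⇒0≤y-x (≤u x)
    ; ≤u  = +ᴹ-cancelʳ-≤ (val x) (≤-≈-≈
              (≈ᴹ-trans (+ᴹ-identityʳ u) (≈ᴹ-sym (x-z+z≈x u (val x)))) ≈ᴹ-refl
              (+ᴹ-monoʳ-≤ u (0≤ x)))
    }

  0# : [0,u]
  0# = record { val = 0ᴹ ; 0≤ = ≤-refl ; ≤u = 0≤u }

  scale : (q : ℚ) → 0ℚ ℚ.≤ q → q ℚ.≤ 1ℚ → [0,u] → [0,u]
  scale q 0≤q q≤1 x = record
    { val = q *ₗ val x
    ; 0≤  = 0≤qx 0≤q
    ; ≤u  = ≤-trans qx≤x (≤u x)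
    }
    where
    0≤qx : ∀ {r} → 0ℚ ℚ.≤ r → 0ᴹ ≤ r *ₗ val x
    0≤qx {r} 0≤r = ≤-≈-≈ (*ₗ-zeroʳ r) ≈ᴹ-refl (*ₗ-monoʳ-≤ 0≤r (0≤ x))

    0≤1-q : 0ℚ ℚ.≤ 1ℚ ℚ.- q
    0≤1-q = ≡.subst (ℚ._≤ 1ℚ ℚ.- q) (ℚ.+-inverseʳ q) (ℚ.+-monoˡ-≤ (ℚ.- q) q≤1)

    [1-q]+q≡1 : (1ℚ ℚ.- q) ℚ.+ q ≡ 1ℚ
    [1-q]+q≡1 = ≡.trans (ℚ.+-assoc 1ℚ (ℚ.- q) q)
      (≡.trans (≡.cong (1ℚ ℚ.+_) (ℚ.+-inverseˡ q)) (ℚ.+-identityʳ 1ℚ))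

    qx≤x : q *ₗ val x ≤ val x
    qx≤x = ≤-≈-≈ (+ᴹ-identityˡ _)
      (≈ᴹ-trans (≈ᴹ-sym (*ₗ-distribʳ (val x) (1ℚ ℚ.- q) q))
        (≈ᴹ-trans (*ₗ-cong [1-q]+q≡1 ≈ᴹ-refl) (*ₗ-identityˡ (val x))))
      (+ᴹ-monoˡ-≤ (q *ₗ val x) (0≤qx 0≤1-q))

  δ : (n : ℕ) .{{_ : NonZero n}} → [0,u] → [0,u]
  δ n = scale (+ 1 / n) (0≤1/n n) (1/n≤1 n)

  ⊕-comm : ∀ x y → x ⊕ y ≈ y ⊕ x
  ⊕-comm x y = ∧-cong ≈ᴹ-refl (+ᴹ-comm (val x) (val y))

  ⊕-cong : ∀ {x x′ y y′} → x ≈ x′ → y ≈ y′ → x ⊕ y ≈ x′ ⊕ y′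
  ⊕-cong p q = ∧-cong ≈ᴹ-refl (+ᴹ-cong p q)

  ⊕-assoc : ∀ x y z → (x ⊕ y) ⊕ z ≈ x ⊕ (y ⊕ z)
  ⊕-assoc x y z = begin
    u ∧ ((u ∧ (a +ᴹ b)) +ᴹ d) ≈⟨ truncate-absorbs (a +ᴹ b) (0≤ z) ⟩
    u ∧ ((a +ᴹ b) +ᴹ d)       ≈⟨ ∧-cong ≈ᴹ-refl (≈ᴹ-trans (+ᴹ-assoc a b d) (+ᴹ-comm a (b +ᴹ d))) ⟩
    u ∧ ((b +ᴹ d) +ᴹ a)       ≈⟨ ≈ᴹ-sym (truncate-absorbs (b +ᴹ d) (0≤ x)) ⟩
    u ∧ ((u ∧ (b +ᴹ d)) +ᴹ a) ≈⟨ ∧-cong ≈ᴹ-refl (+ᴹ-comm _ a) ⟩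
    u ∧ (a +ᴹ (u ∧ (b +ᴹ d))) ∎
    where
    open ≈-R
    a = val x
    b = val y
    d = val z

  ⊕-identityˡ : ∀ x → 0# ⊕ x ≈ x
  ⊕-identityˡ x = ≈ᴹ-trans (∧-cong ≈ᴹ-refl (+ᴹ-identityˡ (val x))) (x≤y⇒y∧x≈x (≤u x))

  ⊕-commutativeMonoid : CommutativeMonoid (c ⊔ ℓ) ℓ
  ⊕-commutativeMonoid = record
    { Carrier = [0,u]
    ; _≈_     = _≈_
    ; _∙_     = _⊕_
    ; ε       = 0#
    ; isCommutativeMonoid = record
      { isMonoid = record
        { isSemigroup = record
          { isMagma = record
            { isEquivalence = record { refl = ≈ᴹ-refl ; sym = ≈ᴹ-sym ; trans = ≈ᴹ-trans }
            ; ∙-cong        = λ {x} {x′} {y} {y′} → ⊕-cong {x} {x′} {y} {y′}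
            }
          ; assoc = ⊕-assoc
          }
        ; identity = ⊕-identityˡ ,
                     λ x → ≈ᴹ-trans (⊕-comm x 0#) (⊕-identityˡ x)
        }
      ; comm = ⊕-comm
      }
    }

  *-join : ∀ x y → val ((x * ⊕ y) * ⊕ y) ≈ᴹ val x ∨ val y
  *-join x y = ≈ᴹ-trans (∧-cong ≈ᴹ-refl sum≈j) (x≤y⇒y∧x≈x (∨-least (≤u x) (≤u y)))
    where
    a = val x
    b = val y
    j = a ∨ b
    t = (u -ᴹ a) +ᴹ b
    m = u ∧ t

    a+t≈u+b : a +ᴹ t ≈ᴹ u +ᴹ b
    a+t≈u+b = ≈ᴹ-trans (+ᴹ-comm a t) ([x-z+y]+z≈x+y u b a)

    u+b≤j+m : u +ᴹ b ≤ j +ᴹ m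
    u+b≤j+m = ≤-≈-≈ ≈ᴹ-refl (+ᴹ-comm m j) (≤-trans
      (∧-greatest (+ᴹ-monoʳ-≤ u (y≤x∨y a b))
        (≤-≈-≈ a+t≈u+b (+ᴹ-comm j t) (+ᴹ-monoˡ-≤ t (x≤x∨y a b))))
      (∧-+ᴹ u t j))

    a+m≤ : a +ᴹ m ≤ u +ᴹ b
    a+m≤ = ≤-≈-≈ ≈ᴹ-refl a+t≈u+b (+ᴹ-monoʳ-≤ a (x∧y≤y u t))

    b+m≤ : b +ᴹ m ≤ u +ᴹ b
    b+m≤ = ≤-≈-≈ ≈ᴹ-refl (+ᴹ-comm b u) (+ᴹ-monoʳ-≤ b (x∧y≤x u t))

    back : ((u -ᴹ m) +ᴹ b) +ᴹ m ≈ᴹ u +ᴹ b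
    back = [x-z+y]+z≈x+y u b m

    sum≈j : (u -ᴹ m) +ᴹ b ≈ᴹ j
    sum≈j = antisym
      (+ᴹ-cancelʳ-≤ m (≤-≈-≈ (≈ᴹ-sym back) ≈ᴹ-refl u+b≤j+m))
      (∨-least (+ᴹ-cancelʳ-≤ m (≤-≈-≈ ≈ᴹ-refl (≈ᴹ-sym back) a+m≤))
               (+ᴹ-cancelʳ-≤ m (≤-≈-≈ ≈ᴹ-refl (≈ᴹ-sym back) b+m≤)))

  mvAlgebra : MVAlgebra (c ⊔ ℓ) ℓ
  mvAlgebra = record
    { commutativeMonoid = ⊕-commutativeMonoid
    ; _*                = _*
    ; *-cong            = λ p → +ᴹ-congˡ (-ᴹ‿cong p)
    ; *-involutive      = λ x → x-[x-y]≈y u (val x)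
    ; łukasiewicz       = λ x y →
        ≈ᴹ-trans (*-join x y) (≈ᴹ-trans (∨-comm (val x) (val y)) (≈ᴹ-sym (*-join y x)))
    ; 0*-zeroˡ          = λ x → antisym
        (≤-trans (x∧y≤x _ _) (≤-reflexive (≈ᴹ-sym u-0≈u)))
        (∧-greatest (≤-reflexive u-0≈u)
          (≤-≈-≈ (+ᴹ-identityʳ _) ≈ᴹ-refl (+ᴹ-monoʳ-≤ (u -ᴹ 0ᴹ) (0≤ x))))
    }
    where
    u-0≈u : u -ᴹ 0ᴹ ≈ᴹ u
    u-0≈u = ≈ᴹ-trans (+ᴹ-congˡ ε⁻¹≈ε) (+ᴹ-identityʳ u)

  open MVAlgebra mvAlgebra using (_·_; _⊙_)

  val-· : ∀ k x → val (k · x) ≈ᴹ u ∧ (k ·ᴹ val x)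
  val-· zero    x = ≈ᴹ-sym (x≤y⇒y∧x≈x 0≤u)
  val-· (suc k) x = begin
    u ∧ (val x +ᴹ val (k · x))         ≈⟨ ∧-cong ≈ᴹ-refl (+ᴹ-congˡ (val-· k x)) ⟩
    u ∧ (val x +ᴹ (u ∧ (k ·ᴹ val x)))  ≈⟨ ∧-cong ≈ᴹ-refl (+ᴹ-comm _ _) ⟩
    u ∧ ((u ∧ (k ·ᴹ val x)) +ᴹ val x)  ≈⟨ truncate-absorbs (k ·ᴹ val x) (0≤ x) ⟩
    u ∧ ((k ·ᴹ val x) +ᴹ val x)        ≈⟨ ∧-cong ≈ᴹ-refl (+ᴹ-comm _ _) ⟩
    u ∧ (val x +ᴹ (k ·ᴹ val x))        ∎
    where open ≈-R

  ·ᴹ-*ₗ : ∀ k q v → k ·ᴹ (q *ₗ v) ≈ᴹ (k ·ℚ q) *ₗ v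
  ·ᴹ-*ₗ zero    q v = ≈ᴹ-sym (*ₗ-zeroˡ v)
  ·ᴹ-*ₗ (suc k) q v = ≈ᴹ-trans (+ᴹ-congˡ (·ᴹ-*ₗ k q v)) (≈ᴹ-sym (*ₗ-distribʳ v q _))

  n·x/n≈x : ∀ n .{{_ : NonZero n}} v → n ·ᴹ ((+ 1 / n) *ₗ v) ≈ᴹ v
  n·x/n≈x n v = ≈ᴹ-trans (·ᴹ-*ₗ n (+ 1 / n) v)
    (≈ᴹ-trans (*ₗ-cong (n·1/n≡1 n) ≈ᴹ-refl) (*ₗ-identityˡ v))

  ·-δ : ∀ n .{{_ : NonZero n}} x → n · δ n x ≈ x
  ·-δ n x = begin
    val (n · δ n x)                    ≈⟨ val-· n (δ n x) ⟩
    u ∧ (n ·ᴹ ((+ 1 / n) *ₗ val x))    ≈⟨ ∧-cong ≈ᴹ-refl (n·x/n≈x n (val x)) ⟩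
    u ∧ val x                          ≈⟨ x≤y⇒y∧x≈x (≤u x) ⟩
    val x                              ∎
    where open ≈-R

  x+y≤u⇒x⊙y≈0 : ∀ x y → val x +ᴹ val y ≤ u → x ⊙ y ≈ 0#
  x+y≤u⇒x⊙y≈0 x y x+y≤u = ≈ᴹ-trans (+ᴹ-congˡ (-ᴹ‿cong truncated)) (-ᴹ‿inverseʳ u)
    where
    a = val x
    b = val y

    u≤ : u ≤ (u -ᴹ a) +ᴹ (u -ᴹ b)
    u≤ = +ᴹ-cancelʳ-≤ (a +ᴹ b) (≤-≈-≈ ≈ᴹ-refl (≈ᴹ-sym split) (+ᴹ-monoʳ-≤ u x+y≤u))
      where
      open ≈-R
      split : ((u -ᴹ a) +ᴹ (u -ᴹ b)) +ᴹ (a +ᴹ b) ≈ᴹ u +ᴹ u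
      split = begin
        ((u -ᴹ a) +ᴹ (u -ᴹ b)) +ᴹ (a +ᴹ b) ≈⟨ ≈ᴹ-sym (+ᴹ-assoc _ a b) ⟩
        (((u -ᴹ a) +ᴹ (u -ᴹ b)) +ᴹ a) +ᴹ b ≈⟨ +ᴹ-congʳ ([x-z+y]+z≈x+y u (u -ᴹ b) a) ⟩
        (u +ᴹ (u -ᴹ b)) +ᴹ b               ≈⟨ +ᴹ-assoc u (u -ᴹ b) b ⟩
        u +ᴹ ((u -ᴹ b) +ᴹ b)               ≈⟨ +ᴹ-congˡ (x-z+z≈x u b) ⟩
        u +ᴹ u                             ∎

    truncated : u ∧ ((u -ᴹ a) +ᴹ (u -ᴹ b)) ≈ᴹ u
    truncated = antisym (x∧y≤x _ _) (∧-greatest ≤-refl u≤)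

  δ-⊙ : ∀ n .{{_ : NonZero n}} x → δ n x ⊙ ((n ℕ.∸ 1) · δ n x) ≈ 0#
  δ-⊙ (suc k) x = x+y≤u⇒x⊙y≈0 (δ (suc k) x) (k · δ (suc k) x) (begin
    v +ᴹ val (k · δ (suc k) x)  ≈⟨ +ᴹ-congˡ (val-· k (δ (suc k) x)) ⟩
    v +ᴹ (u ∧ (k ·ᴹ v))         ≤⟨ +ᴹ-monoʳ-≤ v (x∧y≤y _ _) ⟩
    suc k ·ᴹ v                  ≈⟨ n·x/n≈x (suc k) (val x) ⟩
    val x                       ≤⟨ ≤u x ⟩
    u                           ∎)
    where
    open ≤-R
    v = (+ 1 / suc k) *ₗ val x

  dmvAlgebra : DMVAlgebra (c ⊔ ℓ) ℓ
  dmvAlgebra = record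
    { mvAlgebra = mvAlgebra
    ; δ         = δ
    ; δ-cong    = λ n p → *ₗ-cong ≡.refl p
    ; ·-δ       = ·-δ
    ; δ-⊙       = δ-⊙
    }

module _ {c ℓ c′ ℓ′ : Level}
         {V : UnitalQVectorLattice c ℓ} {W : UnitalQVectorLattice c′ ℓ′}
         (f : UnitalQVectorLatticeHomomorphism V W) where
  private
    module V = UnitalQVectorLattice V
    module W = UnitalQVectorLattice W
    module VI = UnitInterval V
    module WI = UnitInterval W
    open UnitalQVectorLatticeHomomorphism f
    open IsLattice using (x∧y≤y; ∧-greatest; antisym; refl; trans; reflexive)

    mono : ∀ {x y} → x V.≤ y → ⟦ x ⟧ W.≤ ⟦ y ⟧
    mono {x} {y} x≤y = trans W.isLattice
      (reflexive W.isLattice (W.≈ᴹ-trans (W.≈ᴹ-sym (⟦⟧-cong x∧y≈x)) (∧-homo x y)))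
      (x∧y≤y W.isLattice ⟦ x ⟧ ⟦ y ⟧)
      where
      x∧y≈x : x V.∧ y V.≈ᴹ x
      x∧y≈x = antisym V.isLattice (IsLattice.x∧y≤x V.isLattice x y)
        (∧-greatest V.isLattice (refl V.isLattice) x≤y)

    ∧-congᵂ : ∀ {x x′ y y′} → x W.≈ᴹ x′ → y W.≈ᴹ y′ → x W.∧ y W.≈ᴹ x′ W.∧ y′
    ∧-congᵂ = MeetProperties.∧-cong
      (Lattice.meetSemilattice (record { isLattice = W.isLattice }))

  restrict : VI.[0,u] → WI.[0,u]
  restrict (VI.interval x 0≤x x≤u) = record
    { val = ⟦ x ⟧
    ; 0≤  = trans W.isLattice (reflexive W.isLattice (W.≈ᴹ-sym 0ᴹ-homo)) (mono 0≤x)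
    ; ≤u  = trans W.isLattice (mono x≤u) (reflexive W.isLattice u-homo)
    }

  restrictHomomorphism : DMVHomomorphism VI.dmvAlgebra WI.dmvAlgebra
  restrictHomomorphism = record
    { ⟦_⟧ = restrict
    ; ⊕-isMonoidHomomorphism = record
      { isMagmaHomomorphism = record
        { isRelHomomorphism = record { cong = ⟦⟧-cong }
        ; homo = λ x y → W.≈ᴹ-trans (∧-homo _ _) (∧-congᵂ u-homo (+ᴹ-homo _ _))
        }
      ; ε-homo = 0ᴹ-homo
      }
    ; *-homo = λ x → W.≈ᴹ-trans (+ᴹ-homo _ _) (W.+ᴹ-cong u-homo (-ᴹ-homo _))
    ; δ-homo = λ n x → *ₗ-homo (+ 1 / n) _
    }

-- An element of [0,u] carries proofs of 0 ≤ x and x ≤ u, so the carrier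
-- of [0,u] lives at level c ⊔ ℓ.
Γℚ : (c ℓ : Level) → Functor (uQVL (c ⊔ ℓ) ℓ) (DMV (c ⊔ ℓ) ℓ)
Γℚ c ℓ = record
  { F₀           = UnitInterval.dmvAlgebra
  ; F₁           = restrictHomomorphism
  ; F-resp-≈     = λ f≈g x → f≈g (UnitInterval.[0,u].val x)
  ; identity     = λ {V} _ → UnitalQVectorLattice.≈ᴹ-refl V
  ; homomorphism = λ {U} {V} {W} _ → UnitalQVectorLattice.≈ᴹ-refl W
  }

-- Divisibility replaces the good sequences of Mundici's construction. Elements of a DMV-algebra A
-- have unique halves, so a pair (k , x) can stand for 2ᵏ x, and two pairs can be brought to a common
-- scale and halved once more, where their sum is not truncated. These pairs form a cancellative
-- lattice-ordered cone with initial segment A. Its group of differences is lattice-ordered, hence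
-- torsion-free, and divisible, hence a ℚ-vector lattice in exactly one way. Conversely, the
-- evaluation (k , x) ↦ 2ᵏ x of pairs over [0,u] extends to an additive order isomorphism onto V,
-- because |v| ≤ n u makes v the difference of the bounded positive elements v + n u and n u.
module Submission where

open import Algebra.Bundles using (AbelianGroup; CommutativeMonoid)
import Algebra.Definitions.RawMonoid as RawMult
open import Algebra.Module.Morphism.Structures using (IsLeftModuleHomomorphism)
import Algebra.Properties.AbelianGroup as AbelianGroupProperties
import Algebra.Properties.CommutativeMonoid.Mult as Mult
import Algebra.Properties.CommutativeSemigroup as CommutativeSemigroupProperties
open import Data.Integer.Base as ℤ using (ℤ; +_; -[1+_])
import Data.Integer.Properties as ℤ
open import Data.Nat.Base as ℕ using (ℕ; zero; suc)
import Data.Nat.Properties as ℕ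
open import Data.Nat.Tactic.RingSolver using (solve-∀)
open import Data.Product.Base as Product using (∃; _,_; proj₁; proj₂)
open import Data.Rational.Base as ℚ using (ℚ; mkℚ; 0ℚ; 1ℚ; toℚᵘ; _/_)
import Data.Rational.Properties as ℚ
open import Data.Rational.Unnormalised.Base as ℚᵘ using (mkℚᵘ)
import Data.Rational.Unnormalised.Properties as ℚᵘ
open import Level using (Level; _⊔_; Setω) renaming (suc to lsuc)
open import Relation.Binary.Construct.Interior.Symmetric as Interior using (SymInterior; _,_)
open import Relation.Binary.Core using (Rel)
open import Relation.Binary.Lattice using (IsLattice; JoinSemilattice)
open import Relation.Binary.Lattice.Definitions using (Infimum; Supremum)
import Relation.Binary.Lattice.Properties.JoinSemilattice as JoinProperties
open import Relation.Binary.PropositionalEquality.Core as ≡ using (_≡_)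
import Relation.Binary.Reasoning.Setoid as SetoidReasoning
open import Relation.Binary.Structures using (IsPartialOrder)
open import Defs

-- Order and untruncated sums in MV-algebras

-- The obstacle throughout is truncation. The operation `⊕` is not cancellative, and n y = x alone
-- leaves `y` undetermined: in [0,1] every y ≥ 1/2 has double 1. Cancellation in `A` therefore
-- always goes through the relation `_⊥_`, under which `⊕` behaves like the addition of an ordered
-- group; for the summands of n δₙ x it is exactly what the axiom on `⊙` supplies. Of the operators,
-- only `δ 2` enters the order, the sum and the join of the cone, and the others supply its
-- division. Equality of pairs and of differences is inequality in both directions, so no quotient
-- is formed and well-definedness becomes monotonicity.

module MVOrder {c ℓ : Level} (A : MVAlgebra c ℓ) where
  open MVAlgebra A
  open CommutativeSemigroupProperties (CommutativeMonoid.commutativeSemigroup commutativeMonoid)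
    using (interchange; x∙yz≈y∙xz)
  open SetoidReasoning setoid

  infix  4 _≤_ _⊥_
  infixl 6 _⊖_
  infixl 6 _∨_

  1# : Carrier
  1# = 0# *

  -- `x * ⊕ y` is the Łukasiewicz implication from x to y. An inequality is thus an equation between
  -- terms, which makes every homomorphism monotone.
  _≤_ : Carrier → Carrier → Set ℓ
  x ≤ y = x * ⊕ y ≈ 1#

  -- x ⊥ y says that x ⊕ y is the untruncated sum of x and y.
  _⊥_ : Carrier → Carrier → Set ℓ
  x ⊥ y = x ≤ y *

  -- In [0,u] this is the positive part of x - y.
  _⊖_ : Carrier → Carrier → Carrier
  x ⊖ y = (x * ⊕ y) *

  _∨_ : Carrier → Carrier → Carrier
  x ∨ y = (x ⊖ y) ⊕ y

  _∧_ : Carrier → Carrier → Carrier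
  x ∧ y = (x * ∨ y *) *

  ⊕-1ˡ : ∀ x → 1# ⊕ x ≈ 1#
  ⊕-1ˡ = 0*-zeroˡ

  ⊕-1ʳ : ∀ x → x ⊕ 1# ≈ 1#
  ⊕-1ʳ x = trans (comm x 1#) (⊕-1ˡ x)

  ≤-refl : ∀ {x} → x ≤ x
  ≤-refl {x} = begin
    x * ⊕ x              ≈⟨ ∙-congʳ (*-cong (identityˡ x)) ⟨
    (0# ⊕ x) * ⊕ x       ≈⟨ ∙-congʳ (*-cong (∙-congʳ (*-involutive 0#))) ⟨
    (1# * ⊕ x) * ⊕ x     ≈⟨ łukasiewicz 1# x ⟩
    (x * ⊕ 1#) * ⊕ 1#    ≈⟨ ⊕-1ʳ _ ⟩
    1#                   ∎

  ≤-reflexive : ∀ {x y} → x ≈ y → x ≤ y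
  ≤-reflexive {x} x≈y = trans (∙-congˡ (sym x≈y)) ≤-refl

  ≤⇒∨≈ : ∀ {x y} → x ≤ y → x ∨ y ≈ y
  ≤⇒∨≈ {x} {y} x≤y = begin
    (x * ⊕ y) * ⊕ y  ≈⟨ ∙-congʳ (*-cong x≤y) ⟩
    1# * ⊕ y         ≈⟨ ∙-congʳ (*-involutive 0#) ⟩
    0# ⊕ y           ≈⟨ identityˡ y ⟩
    y                ∎

  ≤⇒∨≈′ : ∀ {x y} → x ≤ y → y ∨ x ≈ y
  ≤⇒∨≈′ {x} {y} x≤y = trans (łukasiewicz y x) (≤⇒∨≈ x≤y)

  ≤-antisym : ∀ {x y} → x ≤ y → y ≤ x → x ≈ y
  ≤-antisym x≤y y≤x = trans (sym (≤⇒∨≈′ y≤x)) (≤⇒∨≈ x≤y)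

  ≤-trans : ∀ {x y z} → x ≤ y → y ≤ z → x ≤ z
  ≤-trans {x} {y} {z} x≤y y≤z = begin
    x * ⊕ z              ≈⟨ ∙-congˡ (≤⇒∨≈′ y≤z) ⟨
    x * ⊕ ((z ⊖ y) ⊕ y)  ≈⟨ x∙yz≈y∙xz (x *) (z ⊖ y) y ⟩
    (z ⊖ y) ⊕ (x * ⊕ y)  ≈⟨ ∙-congˡ x≤y ⟩
    (z ⊖ y) ⊕ 1#         ≈⟨ ⊕-1ʳ _ ⟩
    1#                   ∎

  -- One half of residuation: subtracting y is left adjoint to adding y. Monotonicity of `⊕` and the
  -- universal property of `∨` are drawn from this adjunction.
  ⊖-adjointˡ : ∀ {x y z} → x ⊖ y ≤ z → x ≤ y ⊕ z
  ⊖-adjointˡ {x} {y} {z} p = begin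
    x * ⊕ (y ⊕ z)         ≈⟨ assoc _ y z ⟨
    (x * ⊕ y) ⊕ z         ≈⟨ ∙-congʳ (*-involutive _) ⟨
    (x * ⊕ y) * * ⊕ z     ≈⟨ p ⟩
    1#                    ∎

  ⊖-adjointʳ : ∀ {x y z} → x ≤ y ⊕ z → x ⊖ y ≤ z
  ⊖-adjointʳ {x} {y} {z} p = begin
    (x * ⊕ y) * * ⊕ z     ≈⟨ ∙-congʳ (*-involutive _) ⟩
    (x * ⊕ y) ⊕ z         ≈⟨ assoc _ y z ⟩
    x * ⊕ (y ⊕ z)         ≈⟨ p ⟩
    1#                    ∎

  ≤-resp-≈ : ∀ {x x′ y y′} → x ≈ x′ → y ≈ y′ → x ≤ y → x′ ≤ y′
  ≤-resp-≈ p q x≤y = ≤-trans (≤-reflexive (sym p)) (≤-trans x≤y (≤-reflexive q))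

  ⊕-monoʳ-≤ : ∀ z {x y} → x ≤ y → z ⊕ x ≤ z ⊕ y
  ⊕-monoʳ-≤ z x≤y = ⊖-adjointˡ (≤-trans (⊖-adjointʳ ≤-refl) x≤y)

  ⊕-mono-≤ : ∀ {x y z w} → x ≤ y → z ≤ w → x ⊕ z ≤ y ⊕ w
  ⊕-mono-≤ p q = ≤-trans (⊕-monoʳ-≤ _ q) (≤-resp-≈ (comm _ _) (comm _ _) (⊕-monoʳ-≤ _ p))

  *-antitone : ∀ {x y} → x ≤ y → y * ≤ x *
  *-antitone {x} {y} x≤y = trans (∙-congʳ (*-involutive y)) (trans (comm y (x *)) x≤y)

  *-antitoneˡ : ∀ {x y} → x * ≤ y → y * ≤ x
  *-antitoneˡ p = ≤-resp-≈ refl (*-involutive _) (*-antitone p)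

  ⊥-sym : ∀ {x y} → x ⊥ y → y ⊥ x
  ⊥-sym x⊥y = ≤-resp-≈ (*-involutive _) refl (*-antitone x⊥y)

  ⊥-mono : ∀ {x x′ y y′} → x ≤ x′ → y ≤ y′ → x′ ⊥ y′ → x ⊥ y
  ⊥-mono p q r = ≤-trans p (≤-trans r (*-antitone q))

  0≤ : ∀ x → 0# ≤ x
  0≤ = ⊕-1ˡ

  ≤1 : ∀ x → x ≤ 1#
  ≤1 x = ⊕-1ʳ (x *)

  x≤x⊕y : ∀ x y → x ≤ x ⊕ y
  x≤x⊕y x y = ≤-resp-≈ (identityʳ x) refl (⊕-monoʳ-≤ x (0≤ y))

  y≤x⊕y : ∀ x y → y ≤ x ⊕ y
  y≤x⊕y x y = ≤-resp-≈ refl (comm y x) (x≤x⊕y y x)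

  x⊖y≤x : ∀ x y → x ⊖ y ≤ x
  x⊖y≤x x y = ⊖-adjointʳ (y≤x⊕y y x)

  ⊖-⊥ : ∀ x y → x ⊖ y ⊥ y
  ⊖-⊥ x y = *-antitone (y≤x⊕y (x *) y)

  ⊖-⊕ : ∀ {x y} → y ≤ x → (x ⊖ y) ⊕ y ≈ x
  ⊖-⊕ = ≤⇒∨≈′

  y≤x∨y : ∀ x y → y ≤ x ∨ y
  y≤x∨y x y = y≤x⊕y (x ⊖ y) y

  x≤x∨y : ∀ x y → x ≤ x ∨ y
  x≤x∨y x y = ≤-resp-≈ refl (łukasiewicz y x) (y≤x∨y y x)

  ∨-cong : ∀ {x x′ y y′} → x ≈ x′ → y ≈ y′ → x ∨ y ≈ x′ ∨ y′
  ∨-cong p q = ⊕-cong (*-cong (⊕-cong (*-cong p) q)) q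

  ∨-least : ∀ {x y z} → x ≤ z → y ≤ z → x ∨ y ≤ z
  ∨-least {x} {y} {z} x≤z y≤z = ≤-resp-≈ refl (⊖-⊕ y≤z)
    (⊕-mono-≤ (⊖-adjointʳ (≤-trans x≤z (≤-reflexive (trans (sym (⊖-⊕ y≤z)) (comm _ _))))) ≤-refl)

  x∧y≤x : ∀ x y → x ∧ y ≤ x
  x∧y≤x x y = *-antitoneˡ (x≤x∨y (x *) (y *))

  x∧y≤y : ∀ x y → x ∧ y ≤ y
  x∧y≤y x y = *-antitoneˡ (y≤x∨y (x *) (y *))

  ∧-greatest : ∀ {x y z} → z ≤ x → z ≤ y → z ≤ x ∧ y
  ∧-greatest p q = ≤-resp-≈ (*-involutive _) refl (*-antitone (∨-least (*-antitone p) (*-antitone q)))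

  -- The adjunction gives (x ⊕ z) ⊖ z ≤ y, and subtraction undoes an untruncated sum. The sum on the
  -- right may be truncated.
  ⊕-cancelʳ-≤ : ∀ {x y z} → x ⊥ z → x ⊕ z ≤ y ⊕ z → x ≤ y
  ⊕-cancelʳ-≤ {x} {y} {z} x⊥z p =
    ≤-resp-≈ [x⊕z]⊖z≈x refl (⊖-adjointʳ (≤-resp-≈ refl (comm y z) p))
    where
    [x⊕z]⊖z≈x : (x ⊕ z) ⊖ z ≈ x
    [x⊕z]⊖z≈x = begin
      ((x ⊕ z) * ⊕ z) *        ≈⟨ *-cong (∙-congʳ (*-cong (∙-congʳ (*-involutive x)))) ⟨
      -- Inside the outer complement stands `x * ∨ z`, which is `x *` because `z ≤ x *`.
      ((x * * ⊕ z) * ⊕ z) *    ≈⟨ *-cong (≤⇒∨≈′ (⊥-sym x⊥z)) ⟩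
      x * *                    ≈⟨ *-involutive x ⟩
      x                        ∎

  ⊕-cancelʳ : ∀ {x y z} → x ⊥ z → y ⊥ z → x ⊕ z ≈ y ⊕ z → x ≈ y
  ⊕-cancelʳ p q e = ≤-antisym (⊕-cancelʳ-≤ p (≤-reflexive e)) (⊕-cancelʳ-≤ q (≤-reflexive (sym e)))

  -- The complement of x ⊕ y is `x * ⊖ y`, so z fits into what y leaves of `x *`; adding y back is
  -- possible because y ≤ `x *`.
  ⊥-assocˡ : ∀ {x y z} → x ⊥ y → x ⊕ y ⊥ z → x ⊥ y ⊕ z
  ⊥-assocˡ {x} {y} {z} x⊥y p = ⊥-sym (≤-resp-≈ (comm z y) (⊖-⊕ (⊥-sym x⊥y)) (⊕-mono-≤ z≤ ≤-refl))
    where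
    z≤ : z ≤ x * ⊖ y
    z≤ = ≤-resp-≈ refl (*-cong (∙-congʳ (sym (*-involutive x)))) (⊥-sym p)

  ⊥-assocʳ : ∀ {x y z} → y ⊥ z → x ⊥ y ⊕ z → x ⊕ y ⊥ z
  ⊥-assocʳ {x} {y} {z} y⊥z p = ⊥-mono (≤-reflexive (comm x y)) ≤-refl
    (⊥-sym (⊥-assocˡ (⊥-sym y⊥z) (⊥-sym (⊥-mono ≤-refl (≤-reflexive (comm z y)) p))))

  double : Carrier → Carrier
  double x = x ⊕ x

  double-⊕ : ∀ x y → double (x ⊕ y) ≈ double x ⊕ double y
  double-⊕ x y = interchange x y x y

  double-mono : ∀ {x y} → x ≤ y → double x ≤ double y
  double-mono p = ⊕-mono-≤ p p

  double-⊥ : ∀ {x y} → x ⊥ y → x ⊕ y ⊥ x ⊕ y → double x ⊥ double y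
  double-⊥ {x} {y} x⊥y p =
    ⊥-assocʳ (⊥-mono ≤-refl 2y≤ x⊥y+x+y) (⊥-mono ≤-refl (≤-reflexive (x∙yz≈y∙xz x y y)) x⊥y+x+y)
    where
    x⊥y+x+y : x ⊥ y ⊕ (x ⊕ y)
    x⊥y+x+y = ⊥-assocˡ x⊥y p
    2y≤ : double y ≤ y ⊕ (x ⊕ y)
    2y≤ = ⊕-mono-≤ ≤-refl (y≤x⊕y x y)

  -- Dividing p and q by their meet leaves disjoint d and e with 2d ≤ 2e, which forces d = 0.
  double-cancel-≤ : ∀ {p q} → p ⊥ p → q ⊥ q → double p ≤ double q → p ≤ q
  double-cancel-≤ {p} {q} p⊥p q⊥q 2p≤2q =
    ≤-trans (≤-resp-≈ d⊕w≈p refl (⊕-mono-≤ d≤0 ≤-refl)) (≤-resp-≈ (sym (identityˡ w)) refl (x∧y≤y p q))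
    where
    w = p ∧ q
    d = p ⊖ w
    e = q ⊖ w

    d⊕w≈p : d ⊕ w ≈ p
    d⊕w≈p = ⊖-⊕ (x∧y≤x p q)

    e⊕w≈q : e ⊕ w ≈ q
    e⊕w≈q = ⊖-⊕ (x∧y≤y p q)

    disjoint : ∀ {t} → t ≤ d → t ≤ e → t ≤ 0#
    disjoint t≤d t≤e = ⊕-cancelʳ-≤ (≤-trans t≤d (⊖-⊥ p w)) (≤-resp-≈ refl (sym (identityˡ w))
      (∧-greatest (≤-resp-≈ refl d⊕w≈p (⊕-mono-≤ t≤d ≤-refl))
                  (≤-resp-≈ refl e⊕w≈q (⊕-mono-≤ t≤e ≤-refl))))

    2d≤2e : double d ≤ double e
    2d≤2e = ⊕-cancelʳ-≤
      (double-⊥ (⊖-⊥ p w) (⊥-mono (≤-reflexive d⊕w≈p) (≤-reflexive d⊕w≈p) p⊥p))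
      (≤-resp-≈ (double-split d⊕w≈p) (double-split e⊕w≈q) 2p≤2q)
      where
      double-split : ∀ {x y z} → x ⊕ y ≈ z → double z ≈ double x ⊕ double y
      double-split eq = trans (⊕-cong (sym eq) (sym eq)) (double-⊕ _ _)

    -- `d ⊖ e` lies below d, and below e because d ≤ 2d ≤ 2e; disjointness makes it zero.
    d≤e : d ≤ e
    d≤e = ≤-resp-≈ refl (identityʳ e) (⊖-adjointˡ
      (disjoint (x⊖y≤x d e) (⊖-adjointʳ (≤-trans (x≤x⊕y d d) 2d≤2e))))

    d≤0 : d ≤ 0#
    d≤0 = disjoint ≤-refl d≤e

-- Unique halves in a DMV-algebra

module Halving {c ℓ : Level} (A : DMVAlgebra c ℓ) where
  open DMVAlgebra A
  open MVOrder mvAlgebra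
  open SetoidReasoning setoid

  half : Carrier → Carrier
  half = δ 2

  half-cong : ∀ {x y} → x ≈ y → half x ≈ half y
  half-cong = δ-cong 2

  double-half : ∀ x → double (half x) ≈ x
  double-half x = trans (∙-congˡ (sym (identityʳ (half x)))) (·-δ 2 x)

  ⊙≈0⇒⊥ : ∀ {x y} → x ⊙ y ≈ 0# → x ⊥ y
  ⊙≈0⇒⊥ p = trans (sym (*-involutive _)) (*-cong p)

  half-⊥-half : ∀ x → half x ⊥ half x
  -- The axiom at n = 2 speaks of `1 · half x`, which unfolds to `half x ⊕ 0#`.
  half-⊥-half x = ⊥-mono ≤-refl (≤-reflexive (sym (identityʳ _))) (⊙≈0⇒⊥ (δ-⊙ 2 x))

  half-mono : ∀ {x y} → x ≤ y → half x ≤ half y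
  half-mono p = double-cancel-≤ (half-⊥-half _) (half-⊥-half _)
    (≤-resp-≈ (sym (double-half _)) (sym (double-half _)) p)

  half-cancel-≤ : ∀ {x y} → half x ≤ half y → x ≤ y
  half-cancel-≤ p = ≤-resp-≈ (double-half _) (double-half _) (double-mono p)

  half≤½ : ∀ x → half x ≤ half 1#
  half≤½ x = half-mono (≤1 x)

  ≤½⇒⊥ : ∀ {x y} → x ≤ half 1# → y ≤ half 1# → x ⊥ y
  ≤½⇒⊥ p q = ⊥-mono p q (half-⊥-half 1#)

  half-⊥ : ∀ x y → half x ⊥ half y
  half-⊥ x y = ≤½⇒⊥ (half≤½ x) (half≤½ y)

  -- The bound `half 1#` excludes truncated doubles; then `double-cancel-≤` applies in both
  -- directions.
  half-unique : ∀ {x y} → x ≤ half 1# → double x ≈ y → x ≈ half y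
  half-unique {x} {y} x≤½ eq = ≤-antisym
    (double-cancel-≤ x⊥x (half-⊥-half y) (≤-reflexive 2x≈))
    (double-cancel-≤ (half-⊥-half y) x⊥x (≤-reflexive (sym 2x≈)))
    where
    x⊥x : x ⊥ x
    x⊥x = ≤½⇒⊥ x≤½ x≤½
    2x≈ : double x ≈ double (half y)
    2x≈ = trans eq (sym (double-half y))

  half-midpoint : ∀ x y → half (half x ⊕ half y) ≈ half (half x) ⊕ half (half y)
  half-midpoint x y = sym (half-unique
    (≤-resp-≈ refl (double-half (half 1#)) (⊕-mono-≤ (half-mono (half≤½ x)) (half-mono (half≤½ y))))
    (trans (double-⊕ _ _) (⊕-cong (double-half _) (double-half _))))

  -- The sum `half x ⊕ half y` has the right double, but `half-unique` would also need it below
  -- `half 1#`. The remainder p of `half (x ⊕ y)` after `half x` inherits this bound, and cancelling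
  -- x from the doubles shows that p is the half of y.
  half-⊕ : ∀ {x y} → x ⊥ y → half (x ⊕ y) ≈ half x ⊕ half y
  half-⊕ {x} {y} x⊥y = begin
    half (x ⊕ y)   ≈⟨ p⊕½x ⟨
    p ⊕ half x     ≈⟨ ∙-congʳ (half-unique p≤½ 2p≈y) ⟩
    half y ⊕ half x ≈⟨ comm _ _ ⟩
    half x ⊕ half y ∎
    where
    p = half (x ⊕ y) ⊖ half x

    p⊕½x : p ⊕ half x ≈ half (x ⊕ y)
    p⊕½x = ⊖-⊕ (half-mono (x≤x⊕y x y))

    p≤½ : p ≤ half 1#
    p≤½ = ≤-trans (x⊖y≤x _ _) (half≤½ _)

    2p≈y : double p ≈ y
    2p≈y = ⊕-cancelʳ
      (⊥-mono ≤-refl (≤-reflexive (sym (double-half x)))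
        (double-⊥ (⊖-⊥ _ _) (⊥-mono (≤-reflexive p⊕½x) (≤-reflexive p⊕½x) (half-⊥-half _))))
      (⊥-sym x⊥y)
      (begin
        double p ⊕ x                ≈⟨ ∙-congˡ (double-half x) ⟨
        double p ⊕ double (half x)  ≈⟨ double-⊕ p (half x) ⟨
        double (p ⊕ half x)         ≈⟨ ⊕-cong p⊕½x p⊕½x ⟩
        double (half (x ⊕ y))       ≈⟨ double-half _ ⟩
        x ⊕ y                       ≈⟨ comm x y ⟩
        y ⊕ x                       ∎)

  -- Doubling w might truncate. Since halves lie below `half 1#`, w may be replaced by its meet v
  -- with `half 1#`; then x and y lie below the untruncated double of v.
  half-∨-least : ∀ {x y w} → half x ≤ w → half y ≤ w → half (x ∨ y) ≤ w
  half-∨-least {x} {y} {w} p q = ≤-trans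
    (double-cancel-≤ (half-⊥-half _) (≤½⇒⊥ v≤½ v≤½)
      (≤-resp-≈ (sym (double-half _)) refl (∨-least (x≤2v p) (x≤2v q))))
    (x∧y≤y _ w)
    where
    v = half 1# ∧ w
    v≤½ : v ≤ half 1#
    v≤½ = x∧y≤x _ w
    x≤2v : ∀ {x} → half x ≤ w → x ≤ double v
    x≤2v {x} p = ≤-resp-≈ (double-half x) refl (double-mono (∧-greatest (half≤½ x) p))

  half-0 : half 0# ≈ 0#
  half-0 = ≤-antisym (≤-resp-≈ refl (double-half 0#) (x≤x⊕y _ _)) (0≤ _)

-- The cone generated by a DMV-algebra

-- The positive cone of a divisible lattice-ordered group. The field `subtract` makes the order the
-- one induced by addition. Joins are enough, since the group gets its meets by negation. `divide n`
-- divides by n + 1.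
record LatticeCone (c ℓ : Level) : Set (lsuc (c ⊔ ℓ)) where
  infix  4 _≤_
  infixl 5 _∨_
  field
    commutativeMonoid : CommutativeMonoid c ℓ

  open CommutativeMonoid commutativeMonoid public
    renaming (_∙_ to infixl 6 _+_; ε to 0#; ∙-cong to +-cong; ∙-congˡ to +-congˡ; ∙-congʳ to +-congʳ)

  field
    _≤_            : Rel Carrier ℓ
    isPartialOrder : IsPartialOrder _≈_ _≤_
    0≤             : ∀ x → 0# ≤ x
    +-monoˡ-≤      : ∀ z {x y} → x ≤ y → x + z ≤ y + z
    +-cancelʳ-≤    : ∀ z {x y} → x + z ≤ y + z → x ≤ y
    subtract       : ∀ {x y} → x ≤ y → ∃ λ z → z + x ≈ y
    _∨_            : Carrier → Carrier → Carrier
    supremum       : Supremum _≤_ _∨_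
    divide         : ∀ n → Carrier → Carrier
    ×-divide       : ∀ n x → RawMult._×_ rawMonoid (suc n) (divide n x) ≈ x

module ScaledAlgebra {c ℓ : Level} (A : DMVAlgebra c ℓ) where
  open DMVAlgebra A
  open MVOrder mvAlgebra
  open Halving A
  open SetoidReasoning setoid

  halve : ℕ → Carrier → Carrier
  halve zero    x = x
  halve (suc k) x = half (halve k x)

  halve-+ : ∀ k l x → halve (k ℕ.+ l) x ≡ halve k (halve l x)
  halve-+ zero    l x = ≡.refl
  halve-+ (suc k) l x = ≡.cong half (halve-+ k l x)

  halve-exp : ∀ {i j k l} x → i ℕ.+ j ≡ k ℕ.+ l → halve i (halve j x) ≡ halve k (halve l x)
  halve-exp {i} {j} {k} {l} x eq =
    ≡.trans (≡.sym (halve-+ i j x)) (≡.trans (≡.cong (λ n → halve n x) eq) (halve-+ k l x))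

  halve-swap : ∀ k l x → halve k (halve l x) ≡ halve l (halve k x)
  halve-swap k l x = halve-exp {k} {l} {l} {k} x (ℕ.+-comm k l)

  halve-cong : ∀ k {x y} → x ≈ y → halve k x ≈ halve k y
  halve-cong zero    p = p
  halve-cong (suc k) p = half-cong (halve-cong k p)

  halve-mono : ∀ k {x y} → x ≤ y → halve k x ≤ halve k y
  halve-mono zero    p = p
  halve-mono (suc k) p = half-mono (halve-mono k p)

  halve-cancel-≤ : ∀ k {x y} → halve k x ≤ halve k y → x ≤ y
  halve-cancel-≤ zero    p = p
  halve-cancel-≤ (suc k) p = halve-cancel-≤ k (half-cancel-≤ p)

  halve-0 : ∀ k → halve k 0# ≈ 0#
  halve-0 zero    = refl
  halve-0 (suc k) = trans (half-cong (halve-0 k)) half-0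

  halve≤ : ∀ k x → halve k x ≤ x
  halve≤ zero    x = ≤-refl
  halve≤ (suc k) x =
    ≤-trans (≤-resp-≈ refl (double-half _) (x≤x⊕y _ _)) (halve≤ k x)

  halve-⊕ : ∀ k {x y} → x ⊥ y → halve k (x ⊕ y) ≈ halve k x ⊕ halve k y
  halve-⊕ zero    x⊥y = refl
  halve-⊕ (suc k) x⊥y = trans (half-cong (halve-⊕ k x⊥y))
    (half-⊕ (⊥-mono (halve≤ k _) (halve≤ k _) x⊥y))

  halve-half-⊕ : ∀ k x y → halve k (half x ⊕ half y) ≈ half (halve k x) ⊕ half (halve k y)
  halve-half-⊕ k x y = trans (halve-⊕ k (half-⊥ x y))
    (⊕-cong (reflexive (halve-swap k 1 x)) (reflexive (halve-swap k 1 y)))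

  halve-∨-least : ∀ k {x y w} → halve k x ≤ w → halve k y ≤ w → halve k (x ∨ y) ≤ w
  halve-∨-least zero    p q = ∨-least p q
  halve-∨-least (suc k) p q =
    ≤-trans (half-mono (halve-∨-least k (x≤x∨y _ _) (y≤x∨y _ _))) (half-∨-least p q)

  -- The pair (k , x) stands for 2ᵏ x.
  Scaled : Set c
  Scaled = ℕ Product.× Carrier

  infix  4 _≲_ _≋_
  infixl 6 _+_
  infixl 5 _⊔ˢ_

  -- The inequality between 2ᵏ x and 2ˡ y, divided by 2ᵏ⁺ˡ: halving stays inside A, whereas doubling
  -- could truncate. A record, unlike a function, lets p and q be inferred from the type.
  record _≲_ (p q : Scaled) : Set ℓ where
    constructor scaled
    field
      unscaled : halve (proj₁ q) (proj₂ p) ≤ halve (proj₁ p) (proj₂ q)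

  open _≲_ public

  -- With equality derived from the order, antisymmetry holds by construction and each congruence is
  -- monotonicity used twice.
  _≋_ : Rel Scaled ℓ
  _≋_ = SymInterior _≲_

  ≲-refl : ∀ {p} → p ≲ p
  ≲-refl = scaled ≤-refl

  ≲-trans : ∀ {p q r} → p ≲ q → q ≲ r → p ≲ r
  ≲-trans {k , x} {l , y} {m , z} (scaled p) (scaled q) = scaled (halve-cancel-≤ l (≤-trans
    (≤-resp-≈ (reflexive (halve-swap m l x)) (reflexive (halve-swap m k y)) (halve-mono m p))
    (≤-resp-≈ refl (reflexive (halve-swap k l z)) (halve-mono k q))))

  isPartialOrder : IsPartialOrder _≋_ _≲_
  isPartialOrder = Interior.isPartialOrder ≲-refl ≲-trans

  open IsPartialOrder isPartialOrder using (module Eq) renaming (isEquivalence to ≋-isEquivalence)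

  ≋-intro : ∀ {k l x y} → halve l x ≈ halve k y → (k , x) ≋ (l , y)
  ≋-intro e = scaled (≤-reflexive e) , scaled (≤-reflexive (sym e))

  ≋-cong : ∀ {k l x y} → k ≡ l → x ≈ y → (k , x) ≋ (l , y)
  ≋-cong {k} ≡.refl e = ≋-intro (halve-cong k e)

  rescale : ∀ k l x → (k ℕ.+ l , halve k x) ≋ (l , x)
  rescale k l x = ≋-intro (reflexive (≡.trans (halve-swap l k x) (≡.sym (halve-+ k l x))))

  _+_ : Scaled → Scaled → Scaled
  (k , x) + (l , y) = suc (k ℕ.+ l) , half (halve l x) ⊕ half (halve k y)

  0ˢ : Scaled
  0ˢ = 0 , 0#

  +-comm : ∀ p q → p + q ≋ q + p
  +-comm (k , x) (l , y) = ≋-cong (≡.cong suc (ℕ.+-comm k l)) (comm _ _)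

  +-identityˡ : ∀ p → 0ˢ + p ≋ p
  +-identityˡ (k , x) = ≋-intro (trans
    (halve-cong k (trans (∙-congʳ (halve-0 (suc k))) (identityˡ _)))
    (reflexive (halve-swap k 1 x)))

  +-assoc : ∀ p q r → (p + q) + r ≋ p + (q + r)
  +-assoc (k , x) (l , y) (m , z) = ≋-cong (index k l m) (begin
    half (halve m (half (halve l x) ⊕ half (halve k y))) ⊕ half (halve (suc (k ℕ.+ l)) z)
      -- Both bracketings have scale k + l + m + 2, so the three summands end as quarters; sums of
      -- halves are never truncated, hence halving distributes over them.
      ≈⟨ ∙-congʳ (trans (half-cong (halve-half-⊕ m _ _)) (half-midpoint _ _)) ⟩
    (half (half (halve m (halve l x))) ⊕ half (half (halve m (halve k y)))) ⊕ half (halve (suc (k ℕ.+ l)) z)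
      ≈⟨ assoc _ _ _ ⟩
    half (half (halve m (halve l x))) ⊕ (half (half (halve m (halve k y))) ⊕ half (halve (suc (k ℕ.+ l)) z))
      ≡⟨ ≡.cong₂ (λ u v → half (half u) ⊕ v) (≡.trans (halve-swap m l x) (≡.sym (halve-+ l m x)))
           (≡.cong₂ (λ u v → half (half u) ⊕ half (half v)) (halve-swap m k y) (halve-+ k l z)) ⟩
    half (halve (suc (l ℕ.+ m)) x) ⊕ (half (half (halve k (halve m y))) ⊕ half (half (halve k (halve l z))))
      ≈⟨ ∙-congˡ (trans (half-cong (halve-half-⊕ k _ _)) (half-midpoint _ _)) ⟨
    half (halve (suc (l ℕ.+ m)) x) ⊕ half (halve k (half (halve m y) ⊕ half (halve l z)))
      ∎)
    where
    index : ∀ k l m → suc (suc (k ℕ.+ l) ℕ.+ m) ≡ suc (k ℕ.+ suc (l ℕ.+ m))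
    index = solve-∀

  -- The common scale is chosen so that, when (k , x) + (m , z) is compared with (l , y) + (m , z),
  -- both sums get the same second summand (see +-common′).
  +-common : ∀ k l m x z → halve (suc (l ℕ.+ m)) (half (halve m x) ⊕ half (halve k z)) ≈
             halve (2 ℕ.+ (m ℕ.+ m)) (halve l x) ⊕ halve (suc (suc (k ℕ.+ m))) (halve l z)
  +-common k l m x z = trans (halve-half-⊕ (suc (l ℕ.+ m)) _ _) (⊕-cong
    (reflexive (halve-exp {suc (suc (l ℕ.+ m))} {m} {2 ℕ.+ (m ℕ.+ m)} {l} x (e₁ l m)))
    (reflexive (halve-exp {suc (suc (l ℕ.+ m))} {k} {suc (suc (k ℕ.+ m))} {l} z (e₂ k l m))))
    where
    e₁ : ∀ l m → suc (suc (l ℕ.+ m)) ℕ.+ m ≡ 2 ℕ.+ (m ℕ.+ m) ℕ.+ l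
    e₁ = solve-∀
    e₂ : ∀ k l m → suc (suc (l ℕ.+ m)) ℕ.+ k ≡ suc (suc (k ℕ.+ m)) ℕ.+ l
    e₂ = solve-∀

  +-common′ : ∀ k l m x z → halve (suc (l ℕ.+ m)) (half (halve m x) ⊕ half (halve k z)) ≈
              halve (2 ℕ.+ (m ℕ.+ m)) (halve l x) ⊕ halve (suc (suc (l ℕ.+ m))) (halve k z)
  +-common′ k l m x z = trans (+-common k l m x z) (∙-congˡ (reflexive
    (halve-exp {suc (suc (k ℕ.+ m))} {l} {suc (suc (l ℕ.+ m))} {k} z (e k l m))))
    where
    e : ∀ k l m → suc (suc (k ℕ.+ m)) ℕ.+ l ≡ suc (suc (l ℕ.+ m)) ℕ.+ k
    e = solve-∀

  +-monoˡ-≤ : ∀ r {p q} → p ≲ q → p + r ≲ q + r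
  +-monoˡ-≤ (m , z) {k , x} {l , y} (scaled p) = scaled (≤-resp-≈
    (sym (+-common k l m x z)) (sym (+-common′ l k m y z))
    (⊕-mono-≤ (halve-mono (2 ℕ.+ (m ℕ.+ m)) p) ≤-refl))

  +-cancelʳ-≤ : ∀ r {p q} → p + r ≲ q + r → p ≲ q
  +-cancelʳ-≤ (m , z) {k , x} {l , y} (scaled p) = scaled (halve-cancel-≤ (2 ℕ.+ (m ℕ.+ m))
    (⊕-cancelʳ-≤ (half-⊥ _ _) (≤-resp-≈ (+-common k l m x z) (+-common′ l k m y z) p)))

  +-cong : ∀ {p p′ q q′} → p ≋ p′ → q ≋ q′ → p + q ≋ p′ + q′
  +-cong {p} {p′} {q} {q′} (p≲ , ≲p) (q≲ , ≲q) = mono p≲ q≲ , mono ≲p ≲q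
    where
    mono : ∀ {p p′ q q′} → p ≲ p′ → q ≲ q′ → p + q ≲ p′ + q′
    mono {p} {p′} {q} {q′} p≲ q≲ = ≲-trans (+-monoˡ-≤ q p≲)
      (≲-trans (SymInterior.lhs≤rhs (+-comm p′ q))
        (≲-trans (+-monoˡ-≤ p′ q≲) (SymInterior.lhs≤rhs (+-comm q′ p′))))

  +-same-scale : ∀ k {x y} → x ⊥ y → (k , x) + (k , y) ≋ (k , x ⊕ y)
  +-same-scale k {x} {y} x⊥y = Eq.trans
    (≋-cong ≡.refl (sym (trans (half-cong (halve-⊕ k x⊥y))
      (half-⊕ (⊥-mono (halve≤ k _) (halve≤ k _) x⊥y)))))
    (rescale (suc k) k (x ⊕ y))

  -- A join never truncates, so in contrast to the sum no additional halving is made.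
  _⊔ˢ_ : Scaled → Scaled → Scaled
  (k , x) ⊔ˢ (l , y) = k ℕ.+ l , halve l x ∨ halve k y

  supremum : Supremum _≲_ _⊔ˢ_
  supremum (k , x) (l , y) = upperˡ , upperʳ , least
    where
    upperˡ : (k , x) ≲ (k , x) ⊔ˢ (l , y)
    upperˡ = scaled (≤-resp-≈ (reflexive (≡.sym (halve-+ k l x))) refl (halve-mono k (x≤x∨y _ _)))

    upperʳ : (l , y) ≲ (k , x) ⊔ˢ (l , y)
    upperʳ = scaled (≤-resp-≈
      (reflexive (≡.trans (halve-swap l k y) (≡.sym (halve-+ k l y)))) refl (halve-mono l (y≤x∨y _ _)))

    least : ∀ r → (k , x) ≲ r → (l , y) ≲ r → (k , x) ⊔ˢ (l , y) ≲ r
    least (m , z) (scaled p) (scaled q) = scaled (halve-∨-least m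
      (≤-resp-≈ (reflexive (halve-swap l m x))
        (reflexive (≡.trans (halve-swap l k z) (≡.sym (halve-+ k l z)))) (halve-mono l p))
      (≤-resp-≈ (reflexive (halve-swap k m y)) (reflexive (≡.sym (halve-+ k l z))) (halve-mono k q)))

  subtract : ∀ {p q} → p ≲ q → ∃ λ r → r + p ≋ q
  subtract {k , x} {l , y} (scaled p) = r , Eq.trans
    (+-cong {r} {r} Eq.refl (Eq.trans (Eq.sym (rescale l k x)) (≋-cong (ℕ.+-comm l k) refl)))
    (Eq.trans (+-same-scale (k ℕ.+ l) (⊖-⊥ _ _))
      (Eq.trans (≋-cong ≡.refl (⊖-⊕ p)) (rescale k l y)))
    where
    r : Scaled
    r = k ℕ.+ l , halve k y ⊖ halve l x

  commutativeMonoidˢ : CommutativeMonoid c ℓ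
  commutativeMonoidˢ = record
    { Carrier = Scaled
    ; _≈_     = _≋_
    ; _∙_     = _+_
    ; ε       = 0ˢ
    ; isCommutativeMonoid = record
      { isMonoid = record
        { isSemigroup = record
          { isMagma = record { isEquivalence = ≋-isEquivalence ; ∙-cong = +-cong }
          ; assoc   = +-assoc
          }
        ; identity = +-identityˡ , λ p → Eq.trans (+-comm p 0ˢ) (+-identityˡ p)
        }
      ; comm = +-comm
      }
    }

  open RawMult (CommutativeMonoid.rawMonoid commutativeMonoidˢ) using () renaming (_×_ to _×ˢ_)

  -- The hypothesis is the form in which `δ-⊙` states that an (n + 1)-fold sum is untruncated; such
  -- a sum can be formed at the scale k itself.
  ×ˢ-scaled : ∀ k n {x} → x ⊥ n · x → suc n ×ˢ (k , x) ≋ (k , suc n · x)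
  ×ˢ-scaled k zero    {x} _   = Eq.trans (Eq.trans (+-comm (k , x) 0ˢ) (+-identityˡ _))
    (≋-cong ≡.refl (sym (identityʳ x)))
  ×ˢ-scaled k (suc n) {x} x⊥nx = Eq.trans
    (+-cong {k , x} Eq.refl (×ˢ-scaled k n (⊥-mono ≤-refl (y≤x⊕y _ _) x⊥nx)))
    (+-same-scale k x⊥nx)

  divideˢ : ℕ → Scaled → Scaled
  divideˢ n (k , x) = k , δ (suc n) x

  ×-divide : ∀ n p → suc n ×ˢ divideˢ n p ≋ p
  ×-divide n (k , x) = Eq.trans (×ˢ-scaled k n (⊙≈0⇒⊥ (δ-⊙ (suc n) x)))
    (≋-cong ≡.refl (·-δ (suc n) x))

  cone : LatticeCone c ℓ
  cone = record
    { commutativeMonoid = commutativeMonoidˢ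
    ; _≤_            = _≲_
    ; isPartialOrder = isPartialOrder
    ; 0≤             = λ { (k , x) → scaled (≤-resp-≈ (sym (halve-0 k)) refl (0≤ x)) }
    ; +-monoˡ-≤      = +-monoˡ-≤
    ; +-cancelʳ-≤    = +-cancelʳ-≤
    ; subtract       = subtract
    ; _∨_            = _⊔ˢ_
    ; supremum       = supremum
    ; divide         = divideˢ
    ; ×-divide       = ×-divide
    }

-- Divisible lattice-ordered groups

-- The common ground of the group of differences and of the additive group of any given ℚ-vector
-- lattice, so that cancellation of multiples serves both.
record DivisibleLatticeGroup (c ℓ : Level) : Set (lsuc (c ⊔ ℓ)) where
  infix  4 _≤_
  infixl 5 _∨_
  field
    abelianGroup : AbelianGroup c ℓ

  open AbelianGroup abelianGroup public
    renaming (_∙_ to infixl 6 _+_; ε to 0#; _⁻¹ to infix 8 -_; ∙-cong to +-cong; ∙-congˡ to +-congˡ;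
              ∙-congʳ to +-congʳ; ⁻¹-cong to -‿cong)

  field
    _≤_            : Rel Carrier ℓ
    isPartialOrder : IsPartialOrder _≈_ _≤_
    +-monoˡ-≤      : ∀ z {x y} → x ≤ y → x + z ≤ y + z
    _∨_            : Carrier → Carrier → Carrier
    supremum       : Supremum _≤_ _∨_
    divide         : ∀ n → Carrier → Carrier
    ×-divide       : ∀ n x → RawMult._×_ rawMonoid (suc n) (divide n x) ≈ x

-- The group of differences of a lattice cone

module Differences {c ℓ : Level} (M : LatticeCone c ℓ) where
  open LatticeCone M
  open CommutativeSemigroupProperties (CommutativeMonoid.commutativeSemigroup commutativeMonoid)
    using (interchange; xy∙z≈xz∙y; xy∙z≈x∙zy)
  private
    module P = IsPartialOrder isPartialOrder

  ≤-resp-≈ : ∀ {x x′ y y′} → x ≈ x′ → y ≈ y′ → x ≤ y → x′ ≤ y′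
  ≤-resp-≈ p q x≤y = P.trans (P.reflexive (sym p)) (P.trans x≤y (P.reflexive q))

  +-mono-≤ : ∀ {x y z w} → x ≤ y → z ≤ w → x + z ≤ y + w
  +-mono-≤ p q = P.trans (+-monoˡ-≤ _ p) (≤-resp-≈ (comm _ _) (comm _ _) (+-monoˡ-≤ _ q))

  joinSemilattice : JoinSemilattice c ℓ ℓ
  joinSemilattice = record
    { isJoinSemilattice = record { isPartialOrder = isPartialOrder ; supremum = supremum } }

  -- Addition preserves joins. Subtraction is only partial in a cone, but z ≤ x + z ≤ w lets w be
  -- written as v + z, and cancelling z puts the join below v.
  ∨-+-least : ∀ {x y z w} → x + z ≤ w → y + z ≤ w → (x ∨ y) + z ≤ w
  ∨-+-least {x} {y} {z} {w} p q with subtract (P.trans z≤x+z p)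
    where
    z≤x+z : z ≤ x + z
    z≤x+z = ≤-resp-≈ (identityˡ z) refl (+-monoˡ-≤ z (0≤ x))
  ... | v , v+z≈w = ≤-resp-≈ refl v+z≈w (+-monoˡ-≤ z (proj₂ (proj₂ (supremum x y)) v
    (+-cancelʳ-≤ z (≤-resp-≈ refl (sym v+z≈w) p)) (+-cancelʳ-≤ z (≤-resp-≈ refl (sym v+z≈w) q))))

  Difference : Set c
  Difference = Carrier Product.× Carrier

  infix  4 _≼_ _≋_
  infixl 6 _+ᵈ_
  infix  8 -ᵈ_
  infixl 5 _∨ᵈ_

  record _≼_ (p q : Difference) : Set ℓ where
    constructor crossed
    field
      uncrossed : proj₁ p + proj₂ q ≤ proj₁ q + proj₂ p

  open _≼_ public

  _≋_ : Rel Difference ℓ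
  _≋_ = SymInterior _≼_

  ≼-refl : ∀ {p} → p ≼ p
  ≼-refl = crossed P.refl

  ≼-trans : ∀ {p q r} → p ≼ q → q ≼ r → p ≼ r
  ≼-trans {_ , b} {_ , d} {_ , f} (crossed p) (crossed q) = crossed (+-cancelʳ-≤ d (P.trans
    (≤-resp-≈ (xy∙z≈xz∙y _ d f) (xy∙z≈xz∙y _ b f) (+-monoˡ-≤ f p))
    (≤-resp-≈ refl (xy∙z≈xz∙y _ d b) (+-monoˡ-≤ b q))))

  ≼-isPartialOrder : IsPartialOrder _≋_ _≼_
  ≼-isPartialOrder = Interior.isPartialOrder ≼-refl ≼-trans

  open IsPartialOrder ≼-isPartialOrder using (module Eq) renaming (isEquivalence to ≋-isEquivalence)

  ≋-cong : ∀ {a b a′ b′} → a ≈ a′ → b ≈ b′ → (a , b) ≋ (a′ , b′)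
  ≋-cong p q = crossed (P.reflexive (+-cong p (sym q))) , crossed (P.reflexive (+-cong (sym p) q))

  _+ᵈ_ : Difference → Difference → Difference
  (a , b) +ᵈ (c , d) = a + c , b + d

  0ᵈ : Difference
  0ᵈ = 0# , 0#

  -ᵈ_ : Difference → Difference
  -ᵈ (a , b) = b , a

  +ᵈ-mono : ∀ {p p′ q q′} → p ≼ p′ → q ≼ q′ → p +ᵈ q ≼ p′ +ᵈ q′
  +ᵈ-mono (crossed p) (crossed q) =
    crossed (≤-resp-≈ (interchange _ _ _ _) (interchange _ _ _ _) (+-mono-≤ p q))

  -ᵈ-antitone : ∀ {p q} → p ≼ q → -ᵈ q ≼ -ᵈ p
  -ᵈ-antitone (crossed p) = crossed (≤-resp-≈ (comm _ _) (comm _ _) p)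

  -ᵈ-inverseˡ : ∀ p → -ᵈ p +ᵈ p ≋ 0ᵈ
  -ᵈ-inverseˡ (a , b) =
    crossed (P.reflexive eq) , crossed (P.reflexive (sym eq))
    where
    eq : (b + a) + 0# ≈ 0# + (a + b)
    eq = trans (identityʳ _) (trans (comm b a) (sym (identityˡ _)))

  -- Both differences are rewritten with the common subtrahend b + d, where the join can be taken in
  -- the minuends.
  _∨ᵈ_ : Difference → Difference → Difference
  (a , b) ∨ᵈ (c , d) = (a + d) ∨ (c + b) , b + d

  supremumᵈ : Supremum _≼_ _∨ᵈ_
  supremumᵈ (a , b) (c , d) =
    crossed (≤-resp-≈ (xy∙z≈x∙zy a d b) refl (+-monoˡ-≤ b (proj₁ (supremum _ _)))) ,
    crossed (≤-resp-≈ (assoc c b d) refl (+-monoˡ-≤ d (proj₁ (proj₂ (supremum _ _))))) ,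
    λ { (e , f) (crossed p) (crossed q) → crossed (∨-+-least
      (≤-resp-≈ (xy∙z≈xz∙y a f d) (assoc e b d) (+-monoˡ-≤ d p))
      (≤-resp-≈ (xy∙z≈xz∙y c f b) (xy∙z≈x∙zy e d b) (+-monoˡ-≤ b q))) }

  abelianGroupᵈ : AbelianGroup c ℓ
  abelianGroupᵈ = record
    { Carrier = Difference
    ; _≈_     = _≋_
    ; _∙_     = _+ᵈ_
    ; ε       = 0ᵈ
    ; _⁻¹     = -ᵈ_
    ; isAbelianGroup = record
      { isGroup = record
        { isMonoid = record
          { isSemigroup = record
            { isMagma = record
              { isEquivalence = ≋-isEquivalence
              ; ∙-cong        = λ (p , p′) (q , q′) → +ᵈ-mono p q , +ᵈ-mono p′ q′
              }
            ; assoc = λ _ _ _ → ≋-cong (assoc _ _ _) (assoc _ _ _)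
            }
          ; identity = (λ _ → ≋-cong (identityˡ _) (identityˡ _)) ,
                       (λ _ → ≋-cong (identityʳ _) (identityʳ _))
          }
        ; inverse = -ᵈ-inverseˡ ,
                    λ p → Eq.trans (≋-cong (comm _ _) (comm _ _)) (-ᵈ-inverseˡ p)
        ; ⁻¹-cong = λ (p , p′) → -ᵈ-antitone p′ , -ᵈ-antitone p
        }
      ; comm = λ _ _ → ≋-cong (comm _ _) (comm _ _)
      }
    }

  open RawMult (AbelianGroup.rawMonoid abelianGroupᵈ) using () renaming (_×_ to _×ᵈ_)
  open RawMult rawMonoid using () renaming (_×_ to _×ᶜ_)

  ×ᵈ-components : ∀ n a b → n ×ᵈ (a , b) ≡ (n ×ᶜ a , n ×ᶜ b)
  ×ᵈ-components zero    a b = ≡.refl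
  ×ᵈ-components (suc n) a b = ≡.cong ((a , b) +ᵈ_) (×ᵈ-components n a b)

  divideᵈ : ℕ → Difference → Difference
  divideᵈ n (a , b) = divide n a , divide n b

  divisibleLatticeGroup : DivisibleLatticeGroup c ℓ
  divisibleLatticeGroup = record
    { abelianGroup   = abelianGroupᵈ
    ; _≤_            = _≼_
    ; isPartialOrder = ≼-isPartialOrder
    ; +-monoˡ-≤      = λ _ p → +ᵈ-mono p ≼-refl
    ; _∨_            = _∨ᵈ_
    ; supremum       = supremumᵈ
    ; divide         = divideᵈ
    ; ×-divide       = λ { n (a , b) → Eq.trans
        (Eq.reflexive (×ᵈ-components (suc n) (divide n a) (divide n b)))
        (≋-cong (×-divide n a) (×-divide n b)) }
    }

  positive : Carrier → Difference
  positive a = a , 0#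

  positive-mono : ∀ {x y} → x ≤ y → positive x ≼ positive y
  positive-mono p = crossed (+-monoˡ-≤ 0# p)

  positive-cancel : ∀ {x y} → positive x ≼ positive y → x ≤ y
  positive-cancel (crossed p) = +-cancelʳ-≤ 0# p

  positive-cong : ∀ {x y} → x ≈ y → positive x ≋ positive y
  positive-cong p = ≋-cong p refl

  positive-+ : ∀ x y → positive (x + y) ≋ positive x +ᵈ positive y
  positive-+ x y = ≋-cong refl (sym (identityˡ 0#))

-- Integer multiples in an abelian group

module IntegerMultiples {c ℓ : Level} (G : AbelianGroup c ℓ) where
  open AbelianGroup G
    renaming (_∙_ to infixl 6 _+_; ε to 0#; _⁻¹ to infix 8 -_; ∙-congˡ to +-congˡ;
              ∙-congʳ to +-congʳ; ⁻¹-cong to -‿cong)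
  open AbelianGroupProperties G using (⁻¹-∙-comm; ⁻¹-involutive; ε⁻¹≈ε)
  open Mult commutativeMonoid
  open CommutativeSemigroupProperties commutativeSemigroup using (interchange)
  open SetoidReasoning setoid

  infixr 8 _•_

  _•_ : ℤ → Carrier → Carrier
  (+ n)    • x = n × x
  -[1+ n ] • x = - (suc n × x)

  •-cong : ∀ i {x y} → x ≈ y → i • x ≈ i • y
  •-cong (+ n)    p = ×-congʳ n p
  •-cong -[1+ n ] p = -‿cong (×-congʳ (suc n) p)

  -- Integers of opposite signs are added as a difference of natural numbers, so this covers both
  -- mixed cases of `•-homo-+`.
  •-⊖ : ∀ m n x → (m ℤ.⊖ n) • x ≈ m × x + - (n × x)
  •-⊖ zero    zero    x = sym (trans (identityˡ _) ε⁻¹≈ε)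
  •-⊖ zero    (suc n) x = sym (identityˡ _)
  •-⊖ (suc m) zero    x = sym (trans (+-congˡ ε⁻¹≈ε) (identityʳ _))
  •-⊖ (suc m) (suc n) x = begin
    (suc m ℤ.⊖ suc n) • x                 ≡⟨ ≡.cong (_• x) (ℤ.[1+m]⊖[1+n]≡m⊖n m n) ⟩
    (m ℤ.⊖ n) • x                         ≈⟨ •-⊖ m n x ⟩
    m × x + - (n × x)                     ≈⟨ identityˡ _ ⟨
    0# + (m × x + - (n × x))              ≈⟨ +-congʳ (inverseʳ x) ⟨
    (x + - x) + (m × x + - (n × x))       ≈⟨ interchange _ _ _ _ ⟩
    (x + m × x) + (- x + - (n × x))       ≈⟨ +-congˡ (⁻¹-∙-comm x (n × x)) ⟩
    (x + m × x) + - (x + n × x)           ∎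

  •-homo-+ : ∀ i j x → (i ℤ.+ j) • x ≈ i • x + j • x
  •-homo-+ (+ m)    (+ n)    x = ×-homo-+ x m n
  •-homo-+ (+ m)    -[1+ n ] x = •-⊖ m (suc n) x
  •-homo-+ -[1+ m ] (+ n)    x = trans (•-⊖ n (suc m) x) (comm _ _)
  •-homo-+ -[1+ m ] -[1+ n ] x = begin
    - (suc (suc (m ℕ.+ n)) × x)           ≡⟨ ≡.cong (λ k → - (suc k × x)) (≡.sym (ℕ.+-suc m n)) ⟩
    - ((suc m ℕ.+ suc n) × x)             ≈⟨ -‿cong (×-homo-+ x (suc m) (suc n)) ⟩
    - (suc m × x + suc n × x)             ≈⟨ ⁻¹-∙-comm _ _ ⟨
    - (suc m × x) + - (suc n × x)         ∎

  •-neg : ∀ i x → (ℤ.- i) • x ≈ - (i • x)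
  •-neg (+ zero)  x = sym ε⁻¹≈ε
  •-neg (+ suc n) x = refl
  •-neg -[1+ n ]  x = sym (⁻¹-involutive _)

  ×-•-assoc : ∀ m j x → (+ m ℤ.* j) • x ≈ m × j • x
  ×-•-assoc zero    j x = refl
  ×-•-assoc (suc m) j x = begin
    (+ suc m ℤ.* j) • x        ≡⟨ ≡.cong (_• x) (ℤ.suc-* (+ m) j) ⟩
    (j ℤ.+ + m ℤ.* j) • x      ≈⟨ •-homo-+ j (+ m ℤ.* j) x ⟩
    j • x + (+ m ℤ.* j) • x    ≈⟨ +-congˡ (×-•-assoc m j x) ⟩
    j • x + m × j • x          ∎

  •-assoc : ∀ i j x → (i ℤ.* j) • x ≈ i • j • x
  •-assoc (+ m)    j x = ×-•-assoc m j x
  •-assoc -[1+ m ] j x = begin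
    (-[1+ m ] ℤ.* j) • x         ≡⟨ ≡.cong (_• x) (≡.sym (ℤ.neg-distribˡ-* (+ suc m) j)) ⟩
    (ℤ.- (+ suc m ℤ.* j)) • x    ≈⟨ •-neg (+ suc m ℤ.* j) x ⟩
    - ((+ suc m ℤ.* j) • x)      ≈⟨ -‿cong (×-•-assoc (suc m) j x) ⟩
    - (suc m × j • x)            ∎

  •-comm : ∀ i j x → i • j • x ≈ j • i • x
  •-comm i j x = begin
    i • j • x       ≈⟨ •-assoc i j x ⟨
    (i ℤ.* j) • x   ≡⟨ ≡.cong (_• x) (ℤ.*-comm i j) ⟩
    (j ℤ.* i) • x   ≈⟨ •-assoc j i x ⟩
    j • i • x       ∎

  •-distrib-+ : ∀ i x y → i • (x + y) ≈ i • x + i • y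
  •-distrib-+ (+ n)    x y = ×-distrib-+ x y n
  •-distrib-+ -[1+ n ] x y =
    trans (-‿cong (×-distrib-+ x y (suc n))) (sym (⁻¹-∙-comm _ _))

  ×-zeroʳ : ∀ n → n × 0# ≈ 0#
  ×-zeroʳ zero    = refl
  ×-zeroʳ (suc n) = trans (identityˡ _) (×-zeroʳ n)

  •-zeroʳ : ∀ i → i • 0# ≈ 0#
  •-zeroʳ (+ n)    = ×-zeroʳ n
  •-zeroʳ -[1+ n ] = trans (-‿cong (×-zeroʳ (suc n))) ε⁻¹≈ε

-- Torsion-freeness and rational scalars in a divisible lattice-ordered group

module RationalMultiples {c ℓ : Level} (G : DivisibleLatticeGroup c ℓ) where
  open DivisibleLatticeGroup G
  open AbelianGroupProperties abelianGroup using (⁻¹-involutive)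
  open Mult commutativeMonoid
  open IntegerMultiples abelianGroup
  open SetoidReasoning setoid
  private
    module P = IsPartialOrder isPartialOrder

  infixl 5 _∧_

  ≤-resp-≈ : ∀ {x x′ y y′} → x ≈ x′ → y ≈ y′ → x ≤ y → x′ ≤ y′
  ≤-resp-≈ p q x≤y = P.trans (P.reflexive (sym p)) (P.trans x≤y (P.reflexive q))

  +-mono-≤ : ∀ {x y z w} → x ≤ y → z ≤ w → x + z ≤ y + w
  +-mono-≤ p q = P.trans (+-monoˡ-≤ _ p) (≤-resp-≈ (comm _ _) (comm _ _) (+-monoˡ-≤ _ q))

  x+z-z≈x : ∀ x z → (x + z) + - z ≈ x
  x+z-z≈x x z = trans (assoc _ _ _) (trans (+-congˡ (inverseʳ z)) (identityʳ x))

  x-z+z≈x : ∀ x z → (x + - z) + z ≈ x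
  x-z+z≈x x z = trans (assoc _ _ _) (trans (+-congˡ (inverseˡ z)) (identityʳ x))

  +-cancelʳ-≤ : ∀ z {x y} → x + z ≤ y + z → x ≤ y
  +-cancelʳ-≤ z p = ≤-resp-≈ (x+z-z≈x _ z) (x+z-z≈x _ z) (+-monoˡ-≤ (- z) p)

  -‿antitone : ∀ {x y} → x ≤ y → - y ≤ - x
  -‿antitone {x} {y} p = +-cancelʳ-≤ (x + y) (≤-resp-≈
    (sym (trans (+-congˡ (comm x y)) (cancel y x))) (sym (cancel x y)) p)
    where
    cancel : ∀ x y → - x + (x + y) ≈ y
    cancel x y = trans (sym (assoc _ _ _)) (trans (+-congʳ (inverseˡ x)) (identityˡ y))

  _∧_ : Carrier → Carrier → Carrier
  x ∧ y = - (- x ∨ - y)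

  infimum : Infimum _≤_ _∧_
  infimum x y =
    ≤-resp-≈ refl (⁻¹-involutive x) (-‿antitone (proj₁ (supremum _ _))) ,
    ≤-resp-≈ refl (⁻¹-involutive y) (-‿antitone (proj₁ (proj₂ (supremum _ _)))) ,
    λ z p q → ≤-resp-≈ (⁻¹-involutive z) refl
      (-‿antitone (proj₂ (proj₂ (supremum _ _)) _ (-‿antitone p) (-‿antitone q)))

  isLattice : IsLattice _≈_ _≤_ _∨_ _∧_
  isLattice = record { isPartialOrder = isPartialOrder ; supremum = supremum ; infimum = infimum }

  open IsLattice isLattice using (x∧y≤x; x∧y≤y; ∧-greatest)

  ×-mono-≤ : ∀ n {x y} → x ≤ y → n × x ≤ n × y
  ×-mono-≤ zero    p = P.refl
  ×-mono-≤ (suc n) p = +-mono-≤ p (×-mono-≤ n p)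

  0≤n×x : ∀ n {x} → 0# ≤ x → 0# ≤ n × x
  0≤n×x n p = ≤-resp-≈ (×-zeroʳ n) refl (×-mono-≤ n p)

  -- An element disjoint from e is disjoint from its multiples: d - n e lies below d because n e ≥
  -- 0, and below e by hypothesis, so it is at most zero and the multiplicity drops by one.
  disjoint-absorb : ∀ {d e} → 0# ≤ d → 0# ≤ e → (∀ {t} → t ≤ d → t ≤ e → t ≤ 0#) →
                    ∀ n → d ≤ n × e → d ≤ 0#
  disjoint-absorb         0≤d 0≤e disjoint zero    d≤ = d≤
  disjoint-absorb {d} {e} 0≤d 0≤e disjoint (suc n) d≤ = disjoint-absorb 0≤d 0≤e disjoint n
    (≤-resp-≈ (x-z+z≈x d ne) (identityˡ ne) (+-monoˡ-≤ ne (disjoint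
      (+-cancelʳ-≤ ne (≤-resp-≈ (trans (identityʳ d) (sym (x-z+z≈x d ne))) refl
        (+-mono-≤ P.refl (0≤n×x n 0≤e))))
      (+-cancelʳ-≤ ne (≤-resp-≈ (sym (x-z+z≈x d ne)) refl d≤)))))
    where ne = n × e

  -- Dividing x and y by their meet leaves disjoint d, e ≥ 0 with d ≤ n d ≤ n e, which forces d ≤ 0.
  ×-cancel-≤ : ∀ n {x y} → suc n × x ≤ suc n × y → x ≤ y
  ×-cancel-≤ n {x} {y} p = P.trans
    (≤-resp-≈ (x-z+z≈x x w) (identityˡ w) (+-monoˡ-≤ w d≤0)) (x∧y≤y x y)
    where
    w = x ∧ y
    d = x + - w
    e = y + - w

    0≤d : 0# ≤ d
    0≤d = ≤-resp-≈ (inverseʳ w) refl (+-monoˡ-≤ (- w) (x∧y≤x x y))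

    0≤e : 0# ≤ e
    0≤e = ≤-resp-≈ (inverseʳ w) refl (+-monoˡ-≤ (- w) (x∧y≤y x y))

    disjoint : ∀ {t} → t ≤ d → t ≤ e → t ≤ 0#
    disjoint t≤d t≤e = +-cancelʳ-≤ w (≤-resp-≈ refl (sym (identityˡ w)) (∧-greatest
      (≤-resp-≈ refl (x-z+z≈x x w) (+-monoˡ-≤ w t≤d))
      (≤-resp-≈ refl (x-z+z≈x y w) (+-monoˡ-≤ w t≤e))))

    nd≤ne : suc n × d ≤ suc n × e
    nd≤ne = ≤-resp-≈ (sym (×-distrib-+ x (- w) (suc n))) (sym (×-distrib-+ y (- w) (suc n)))
      (+-monoˡ-≤ (suc n × - w) p)

    d≤0 : d ≤ 0#
    d≤0 = disjoint-absorb 0≤d 0≤e disjoint (suc n) (P.trans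
      (≤-resp-≈ (identityʳ d) refl (+-mono-≤ P.refl (0≤n×x n 0≤d))) nd≤ne)

  ×-cancel : ∀ n {x y} → suc n × x ≈ suc n × y → x ≈ y
  ×-cancel n p = P.antisym (×-cancel-≤ n (P.reflexive p)) (×-cancel-≤ n (P.reflexive (sym p)))

  infixr 8 _*ₗ_
  -- `mkℚ` stores the denominator minus one, which is the argument that `divide` expects.
  _*ₗ_ : ℚ → Carrier → Carrier
  mkℚ i n _ *ₗ x = i • divide n x

  clear : ∀ q x → suc (ℚ.denominator-1 q) × q *ₗ x ≈ ℚ.numerator q • x
  clear (mkℚ i n _) x = trans (•-comm (+ suc n) i (divide n x)) (•-cong i (×-divide n x))

  -- Sums and products of rationals are reduced to lowest terms, which hides the fractions they come
  -- from. Any fraction equal to q characterises the multiple as well: cross-multiply, then cancel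
  -- both denominators.
  *ₗ-unique : ∀ q {i n} x {y} → toℚᵘ q ℚᵘ.≃ mkℚᵘ i n → suc n × y ≈ i • x → y ≈ q *ₗ x
  *ₗ-unique q@(mkℚ j m _) {i} {n} x {y} (ℚᵘ.*≡* jn≡im) eq = ×-cancel n (×-cancel m (begin
    suc m × suc n × y            ≈⟨ ×-congʳ (suc m) eq ⟩
    suc m × i • x                ≈⟨ •-comm (+ suc m) i x ⟩
    i • suc m × x                ≈⟨ •-assoc i (+ suc m) x ⟨
    (i ℤ.* + suc m) • x          ≡⟨ ≡.cong (_• x) jn≡im ⟨
    (j ℤ.* + suc n) • x          ≈⟨ •-assoc j (+ suc n) x ⟩
    j • suc n × x                ≈⟨ •-comm j (+ suc n) x ⟩
    suc n × j • x                ≈⟨ ×-congʳ (suc n) (clear q x) ⟨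
    suc n × suc m × q *ₗ x       ≈⟨ •-comm (+ suc n) (+ suc m) (q *ₗ x) ⟩
    suc m × suc n × q *ₗ x       ∎))

  ×≈•⇒≈*ₗ : ∀ q x {y} → suc (ℚ.denominator-1 q) × y ≈ ℚ.numerator q • x → y ≈ q *ₗ x
  ×≈•⇒≈*ₗ q x eq = ×-cancel (ℚ.denominator-1 q) (trans eq (sym (clear q x)))

  *ₗ-congˡ : ∀ q {x y} → x ≈ y → q *ₗ x ≈ q *ₗ y
  *ₗ-congˡ q {x} {y} p = ×≈•⇒≈*ₗ q y (trans (clear q x) (•-cong (ℚ.numerator q) p))

  *ₗ-distribʳ : ∀ x p q → (p ℚ.+ q) *ₗ x ≈ p *ₗ x + q *ₗ x
  *ₗ-distribʳ x p@(mkℚ i m _) q@(mkℚ j n _) = sym (*ₗ-unique (p ℚ.+ q) x (ℚ.toℚᵘ-homo-+ p q) (begin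
    (suc m ℕ.* suc n) × (p *ₗ x + q *ₗ x)
      ≈⟨ ×-distrib-+ (p *ₗ x) (q *ₗ x) (suc m ℕ.* suc n) ⟩
    (suc m ℕ.* suc n) × p *ₗ x + (suc m ℕ.* suc n) × q *ₗ x
      ≈⟨ +-cong (trans (×-congˡ (ℕ.*-comm (suc m) (suc n))) (sym (×-assocˡ (p *ₗ x) (suc n) (suc m))))
                (sym (×-assocˡ (q *ₗ x) (suc m) (suc n))) ⟩
    suc n × suc m × p *ₗ x + suc m × suc n × q *ₗ x
      ≈⟨ +-cong (×-congʳ (suc n) (clear p x)) (×-congʳ (suc m) (clear q x)) ⟩
    suc n × i • x + suc m × j • x
      ≈⟨ +-cong (trans (•-comm (+ suc n) i x) (sym (•-assoc i (+ suc n) x)))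
                (trans (•-comm (+ suc m) j x) (sym (•-assoc j (+ suc m) x))) ⟩
    (i ℤ.* + suc n) • x + (j ℤ.* + suc m) • x
      ≈⟨ •-homo-+ (i ℤ.* + suc n) (j ℤ.* + suc m) x ⟨
    (i ℤ.* + suc n ℤ.+ j ℤ.* + suc m) • x
      ∎))
  *ₗ-assoc : ∀ p q x → (p ℚ.* q) *ₗ x ≈ p *ₗ q *ₗ x
  *ₗ-assoc p@(mkℚ i m _) q@(mkℚ j n _) x = sym (*ₗ-unique (p ℚ.* q) x (ℚ.toℚᵘ-homo-* p q) (begin
    (suc m ℕ.* suc n) × p *ₗ q *ₗ x   ≡⟨ ≡.cong (_× p *ₗ q *ₗ x) (ℕ.*-comm (suc m) (suc n)) ⟩
    (suc n ℕ.* suc m) × p *ₗ q *ₗ x   ≈⟨ ×-assocˡ (p *ₗ q *ₗ x) (suc n) (suc m) ⟨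
    suc n × suc m × p *ₗ q *ₗ x       ≈⟨ ×-congʳ (suc n) (clear p (q *ₗ x)) ⟩
    suc n × i • q *ₗ x                ≈⟨ •-comm (+ suc n) i (q *ₗ x) ⟩
    i • suc n × q *ₗ x                ≈⟨ •-cong i (clear q x) ⟩
    i • j • x                         ≈⟨ •-assoc i j x ⟨
    (i ℤ.* j) • x                     ∎))
  *ₗ-identityˡ : ∀ x → 1ℚ *ₗ x ≈ x
  *ₗ-identityˡ x = sym (×≈•⇒≈*ₗ 1ℚ x refl)

  *ₗ-zeroʳ : ∀ q → q *ₗ 0# ≈ 0#
  *ₗ-zeroʳ q = sym (×≈•⇒≈*ₗ q 0#
    (trans (×-zeroʳ (suc (ℚ.denominator-1 q))) (sym (•-zeroʳ (ℚ.numerator q)))))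

  *ₗ-distribˡ : ∀ q x y → q *ₗ (x + y) ≈ q *ₗ x + q *ₗ y
  *ₗ-distribˡ q x y = sym (×≈•⇒≈*ₗ q (x + y) (begin
    suc n × (q *ₗ x + q *ₗ y)               ≈⟨ ×-distrib-+ (q *ₗ x) (q *ₗ y) (suc n) ⟩
    suc n × q *ₗ x + suc n × q *ₗ y         ≈⟨ +-cong (clear q x) (clear q y) ⟩
    ℚ.numerator q • x + ℚ.numerator q • y   ≈⟨ •-distrib-+ (ℚ.numerator q) x y ⟨
    ℚ.numerator q • (x + y)                 ∎))
    where n = ℚ.denominator-1 q

  *ₗ-monoʳ-≤ : ∀ {q} → 0ℚ ℚ.≤ q → ∀ {x y} → x ≤ y → q *ₗ x ≤ q *ₗ y
  *ₗ-monoʳ-≤ {mkℚ -[1+ _ ] _ _} 0≤q with () ← ℚ.nonNegative 0≤q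
  *ₗ-monoʳ-≤ {q@(mkℚ (+ k) n _)} 0≤q {x} {y} x≤y = ×-cancel-≤ n
    (≤-resp-≈ (sym (clear q x)) (sym (clear q y)) (×-mono-≤ k x≤y))

  vectorLattice : QVectorLattice c ℓ
  vectorLattice = record
    { leftModule = record
      { Carrierᴹ = Carrier
      ; _≈ᴹ_     = _≈_
      ; _+ᴹ_     = _+_
      ; _*ₗ_     = _*ₗ_
      ; 0ᴹ       = 0#
      ; -ᴹ_      = -_
      ; isLeftModule = record
        { isLeftSemimodule = record
          { +ᴹ-isCommutativeMonoid = isCommutativeMonoid
          ; isPreleftSemimodule = record
            { *ₗ-cong      = λ { {q} ≡.refl → *ₗ-congˡ q }
            ; *ₗ-zeroˡ     = λ _ → refl
            ; *ₗ-distribʳ  = *ₗ-distribʳ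
            ; *ₗ-identityˡ = *ₗ-identityˡ
            ; *ₗ-assoc     = *ₗ-assoc
            ; *ₗ-zeroʳ     = *ₗ-zeroʳ
            ; *ₗ-distribˡ  = *ₗ-distribˡ
            }
          }
        ; -ᴹ‿cong    = -‿cong
        ; -ᴹ‿inverse = inverse
        }
      }
    ; _≤_        = _≤_
    ; _∨_        = _∨_
    ; _∧_        = _∧_
    ; isLattice  = isLattice
    ; +ᴹ-monoˡ-≤ = +-monoˡ-≤
    ; *ₗ-monoʳ-≤ = *ₗ-monoʳ-≤
    }

-- Additive order isomorphisms of ℚ-vector lattices

module VectorLatticeProperties {c ℓ : Level} (V : UnitalQVectorLattice c ℓ) where
  open UnitalQVectorLattice V
  open UnitInterval V using (·ᴹ-*ₗ; n·x/n≈x)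
  open AbelianGroupProperties +ᴹ-abelianGroup using (inverseˡ-unique)
  open IntegerMultiples +ᴹ-abelianGroup using (_•_) public

  divisibleLatticeGroup : DivisibleLatticeGroup c ℓ
  divisibleLatticeGroup = record
    { abelianGroup   = +ᴹ-abelianGroup
    ; _≤_            = _≤_
    ; isPartialOrder = IsLattice.isPartialOrder isLattice
    ; +-monoˡ-≤      = +ᴹ-monoˡ-≤
    ; _∨_            = _∨_
    ; supremum       = IsLattice.supremum isLattice
    ; divide         = λ n x → (+ 1 / suc n) *ₗ x
    ; ×-divide       = λ n x → n·x/n≈x (suc n) x
    }

  open RationalMultiples divisibleLatticeGroup public using (×-cancel; ×-cancel-≤)

  -ℚ-*ₗ : ∀ q x → (ℚ.- q) *ₗ x ≈ᴹ -ᴹ (q *ₗ x)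
  -ℚ-*ₗ q x = inverseˡ-unique _ _ (≈ᴹ-trans (≈ᴹ-sym (*ₗ-distribʳ x (ℚ.- q) q))
    (≈ᴹ-trans (*ₗ-cong (ℚ.+-inverseˡ q) ≈ᴹ-refl) (*ₗ-zeroˡ x)))

  -- This ties the given scalar multiplication to addition alone. The scalar (d + 1) q is identified
  -- with the numerator among unnormalised fractions, which carry no coprimality proofs.
  clear-denominator : ∀ q x → suc (ℚ.denominator-1 q) ·ᴹ (q *ₗ x) ≈ᴹ ℚ.numerator q • x
  clear-denominator q@(mkℚ i d _) x = ≈ᴹ-trans (·ᴹ-*ₗ (suc d) q x) (numerator i ≡.refl)
    where
    toℚᵘ-cleared : toℚᵘ (suc d ·ℚ q) ℚᵘ.≃ mkℚᵘ i 0
    toℚᵘ-cleared = ℚᵘ.≃-trans (toℚᵘ-·ℚ (suc d) q)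
      (ℚᵘ.*≡* (≡.trans (ℤ.*-identityʳ _) (≡.trans (ℤ.*-comm (+ suc d) i)
        (≡.cong (λ n → i ℤ.* + n) (≡.sym (ℕ.*-identityˡ (suc d)))))))

    toℚᵘ-·1 : ∀ k → toℚᵘ (k ·ℚ 1ℚ) ℚᵘ.≃ mkℚᵘ (+ k) 0
    toℚᵘ-·1 k = ℚᵘ.≃-trans (toℚᵘ-·ℚ k 1ℚ) (ℚᵘ.*-identityʳ (mkℚᵘ (+ k) 0))

    ·ℚ1-*ₗ : ∀ k → (k ·ℚ 1ℚ) *ₗ x ≈ᴹ k ·ᴹ x
    ·ℚ1-*ₗ k = ≈ᴹ-trans (≈ᴹ-sym (·ᴹ-*ₗ k 1ℚ x))
      (Mult.×-congʳ +ᴹ-commutativeMonoid k (*ₗ-identityˡ x))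

    numerator : ∀ j → i ≡ j → (suc d ·ℚ q) *ₗ x ≈ᴹ j • x
    numerator (+ k) ≡.refl = ≈ᴹ-trans
      (*ₗ-cong (ℚ.toℚᵘ-injective (ℚᵘ.≃-trans toℚᵘ-cleared (ℚᵘ.≃-sym (toℚᵘ-·1 k)))) ≈ᴹ-refl)
      (·ℚ1-*ₗ k)
    numerator -[1+ k ] ≡.refl = ≈ᴹ-trans
      (*ₗ-cong (ℚ.toℚᵘ-injective (ℚᵘ.≃-trans toℚᵘ-cleared (ℚᵘ.≃-sym (ℚᵘ.≃-trans
        (ℚ.toℚᵘ-homo‿- (suc k ·ℚ 1ℚ)) (ℚᵘ.-‿cong (toℚᵘ-·1 (suc k))))))) ≈ᴹ-refl)
      (≈ᴹ-trans (-ℚ-*ₗ (suc k ·ℚ 1ℚ) x) (-ᴹ‿cong (·ℚ1-*ₗ (suc k))))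

module _ {c ℓ c′ ℓ′ : Level} (V : UnitalQVectorLattice c ℓ) (W : UnitalQVectorLattice c′ ℓ′) where
  private
    module V where
      open UnitalQVectorLattice V public
      open VectorLatticeProperties V public
      open IsLattice isLattice public
        using (reflexive; antisym; x≤x∨y; y≤x∨y; ∨-least; x∧y≤x; x∧y≤y; ∧-greatest)
    module W where
      open UnitalQVectorLattice W public
      open VectorLatticeProperties W public
      open AbelianGroupProperties +ᴹ-abelianGroup public
      open IsLattice isLattice public
        using (trans; reflexive; antisym; x≤x∨y; y≤x∨y; ∨-least; x∧y≤x; x∧y≤y; ∧-greatest)

  -- Multiplying by the denominator leaves an integer multiple, which every additive map preserves;
  -- W is torsion-free, so the denominator can be cancelled again.
  additive⇒linear : (f : V.Carrierᴹ → W.Carrierᴹ) →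
    (∀ {x y} → x V.≈ᴹ y → f x W.≈ᴹ f y) →
    (∀ x y → f (x V.+ᴹ y) W.≈ᴹ f x W.+ᴹ f y) →
    IsLeftModuleHomomorphism V.rawLeftModule W.rawLeftModule f
  additive⇒linear f f-cong f-+ = record
    { +ᴹ-isGroupHomomorphism = record
      { isMonoidHomomorphism = record
        { isMagmaHomomorphism = record
          { isRelHomomorphism = record { cong = f-cong }
          ; homo = f-+
          }
        ; ε-homo = f-0
        }
      ; ⁻¹-homo = f-neg
      }
    ; *ₗ-homo = f-*ₗ
    }
    where
    f-0 : f V.0ᴹ W.≈ᴹ W.0ᴹ
    f-0 = W.identityʳ-unique (f V.0ᴹ) (f V.0ᴹ)
      (W.≈ᴹ-trans (W.≈ᴹ-sym (f-+ _ _)) (f-cong (V.+ᴹ-identityʳ _)))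

    f-neg : ∀ x → f (V.-ᴹ x) W.≈ᴹ W.-ᴹ f x
    f-neg x = W.inverseˡ-unique _ _
      (W.≈ᴹ-trans (W.≈ᴹ-sym (f-+ _ _)) (W.≈ᴹ-trans (f-cong (V.-ᴹ‿inverseˡ x)) f-0))

    f-· : ∀ n x → f (n V.·ᴹ x) W.≈ᴹ n W.·ᴹ f x
    f-· zero    x = f-0
    f-· (suc n) x = W.≈ᴹ-trans (f-+ _ _) (W.+ᴹ-congˡ (f-· n x))

    f-• : ∀ i x → f (i V.• x) W.≈ᴹ i W.• f x
    f-• (+ n)    x = f-· n x
    f-• -[1+ n ] x = W.≈ᴹ-trans (f-neg _) (W.-ᴹ‿cong (f-· (suc n) x))

    f-*ₗ : ∀ q x → f (q V.*ₗ x) W.≈ᴹ q W.*ₗ f x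
    f-*ₗ q x = W.×-cancel (ℚ.denominator-1 q) (begin
      suc (ℚ.denominator-1 q) W.·ᴹ f (q V.*ₗ x)   ≈⟨ f-· (suc (ℚ.denominator-1 q)) _ ⟨
      f (suc (ℚ.denominator-1 q) V.·ᴹ (q V.*ₗ x)) ≈⟨ f-cong (V.clear-denominator q x) ⟩
      f (ℚ.numerator q V.• x)                     ≈⟨ f-• (ℚ.numerator q) x ⟩
      ℚ.numerator q W.• f x                       ≈⟨ W.clear-denominator q (f x) ⟨
      suc (ℚ.denominator-1 q) W.·ᴹ (q W.*ₗ f x)   ∎)
      where open SetoidReasoning W.≈ᴹ-setoid

  -- Of `from` only the section property is asked, so it may depend on choices such as the bound
  -- given by a strong unit. Order reflection makes it a monotone two-sided inverse, whence `to`
  -- preserves joins and meets.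
  record UnitalOrderIsomorphism : Set (c ⊔ ℓ ⊔ c′ ⊔ ℓ′) where
    field
      to      : V.Carrierᴹ → W.Carrierᴹ
      from    : W.Carrierᴹ → V.Carrierᴹ
      to-≤    : ∀ {x y} → x V.≤ y → to x W.≤ to y
      to-≤⁻¹  : ∀ {x y} → to x W.≤ to y → x V.≤ y
      to-from : ∀ y → to (from y) W.≈ᴹ y
      to-+    : ∀ x y → to (x V.+ᴹ y) W.≈ᴹ to x W.+ᴹ to y
      to-u    : to V.u W.≈ᴹ W.u

    to-cong : ∀ {x y} → x V.≈ᴹ y → to x W.≈ᴹ to y
    to-cong p = W.antisym (to-≤ (V.reflexive p)) (to-≤ (V.reflexive (V.≈ᴹ-sym p)))

    to-injective : ∀ {x y} → to x W.≈ᴹ to y → x V.≈ᴹ y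
    to-injective p = V.antisym (to-≤⁻¹ (W.reflexive p)) (to-≤⁻¹ (W.reflexive (W.≈ᴹ-sym p)))

    from-to : ∀ x → from (to x) V.≈ᴹ x
    from-to x = to-injective (to-from (to x))

    homomorphism : UnitalQVectorLatticeHomomorphism V W
    homomorphism = record
      { ⟦_⟧ = to
      ; isLeftModuleHomomorphism = additive⇒linear to to-cong to-+
      ; ∨-homo = λ x y → W.antisym
          (W.trans (to-≤ (V.∨-least (below (W.x≤x∨y _ _)) (below (W.y≤x∨y _ _))))
            (W.reflexive (to-from _)))
          (W.∨-least (to-≤ (V.x≤x∨y x y)) (to-≤ (V.y≤x∨y x y)))
      ; ∧-homo = λ x y → W.antisym
          (W.∧-greatest (to-≤ (V.x∧y≤x x y)) (to-≤ (V.x∧y≤y x y)))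
          (W.trans (W.reflexive (W.≈ᴹ-sym (to-from _)))
            (to-≤ (V.∧-greatest (above (W.x∧y≤x _ _)) (above (W.x∧y≤y _ _)))))
      ; u-homo = to-u
      }
      where
      below : ∀ {x z} → to x W.≤ z → x V.≤ from z
      below p = to-≤⁻¹ (W.trans p (W.reflexive (W.≈ᴹ-sym (to-from _))))
      above : ∀ {x z} → z W.≤ to x → from z V.≤ x
      above p = to-≤⁻¹ (W.trans (W.reflexive (to-from _)) p)

module _ {c ℓ c′ ℓ′ : Level} {V : UnitalQVectorLattice c ℓ} {W : UnitalQVectorLattice c′ ℓ′}
         (i : UnitalOrderIsomorphism V W) where
  open UnitalOrderIsomorphism i
  private
    module V = UnitalQVectorLattice V
    module W = UnitalQVectorLattice W
    open IsLattice W.isLattice using (trans; reflexive)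

  inverse : UnitalOrderIsomorphism W V
  inverse = record
    { to      = from
    ; from    = to
    ; to-≤    = λ p → to-≤⁻¹ (trans (reflexive (to-from _))
                  (trans p (reflexive (W.≈ᴹ-sym (to-from _)))))
    ; to-≤⁻¹  = λ p → trans (reflexive (W.≈ᴹ-sym (to-from _)))
                  (trans (to-≤ p) (reflexive (to-from _)))
    ; to-from = from-to
    ; to-+    = λ x y → to-injective (W.≈ᴹ-trans (to-from _)
                  (W.≈ᴹ-sym (W.≈ᴹ-trans (to-+ _ _) (W.+ᴹ-cong (to-from x) (to-from y)))))
    ; to-u    = to-injective (W.≈ᴹ-trans (to-from _) (W.≈ᴹ-sym to-u))
    }

-- The enveloping vector lattice of a DMV-algebra

module EnvelopingLattice {c ℓ : Level} (A : DMVAlgebra c ℓ) where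
  open DMVAlgebra A using (Carrier; sym)
  open MVOrder (DMVAlgebra.mvAlgebra A) public
  open Halving A public
  open ScaledAlgebra A public
  open LatticeCone cone using () renaming (commutativeMonoid to coneMonoid)
  open Differences cone public
    using (Difference; _≼_; crossed; positive; positive-mono; positive-cancel; positive-cong;
           positive-+; divisibleLatticeGroup)
  open Mult coneMonoid using (_×_; ×-homo-+)
  private
    module C = Differences cone
    module P = IsPartialOrder isPartialOrder
    module E = CommutativeMonoid coneMonoid
    module G = DivisibleLatticeGroup divisibleLatticeGroup

  embed : Carrier → Scaled
  embed a = 0 , a

  vectorLattice : QVectorLattice c ℓ
  vectorLattice = RationalMultiples.vectorLattice divisibleLatticeGroup

  open QVectorLattice vectorLattice using (_·ᴹ_; IsStrongUnit)

  unit : Difference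
  unit = positive (embed 1#)

  0≤ˢ : ∀ p → 0ˢ ≲ p
  0≤ˢ = LatticeCone.0≤ cone

  ×-mono-≤ : ∀ {m n} p → m ℕ.≤ n → m × p ≲ n × p
  ×-mono-≤ p ℕ.z≤n     = 0≤ˢ _
  ×-mono-≤ p (ℕ.s≤s q) = C.+-mono-≤ {p} P.refl (×-mono-≤ p q)

  bound : ℕ → ℕ
  bound zero    = 1
  bound (suc k) = bound k ℕ.+ bound k

  ≲bound : ∀ k x → (k , x) ≲ bound k × embed 1#
  ≲bound zero    x = P.trans (scaled (≤1 x)) (P.reflexive (E.sym (E.identityʳ _)))
  ≲bound (suc k) x = P.trans (scaled (halve-mono (suc k) (≤1 x))) (P.trans
    -- `(suc k , 1#)` is twice `(k , 1#)`: at scale 2k + 1 both have second component `halve k 1#`.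
    (P.reflexive (E.trans (E.sym (rescale k (suc k) 1#)) (≋-cong (ℕ.+-suc k k) (sym (double-half _)))))
    (C.≤-resp-≈ E.refl (E.sym (×-homo-+ (embed 1#) (bound k) (bound k)))
      (C.+-mono-≤ (≲bound k 1#) (≲bound k 1#))))

  ·-positive : ∀ n p → n ·ᴹ positive p G.≈ positive (n × p)
  ·-positive zero    p = G.refl
  ·-positive (suc n) p = G.trans (G.+-congˡ {positive p} (·-positive n p))
    (G.sym (positive-+ p (n × p)))

  isStrongUnit : IsStrongUnit unit
  isStrongUnit = positive-mono (0≤ˢ _) , λ { (p@(k , x) , q@(l , y)) →
    -- The absolute value of p - q is the join of p - q and q - p. These lie below p and q, so one
    -- multiple of the unit bounding both p and q suffices.
    let n = bound k ℕ.+ bound l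

        below : ∀ {r s} → r ≲ n × embed 1# → (r , s) ≼ n ·ᴹ unit
        below {r} {s} r≲ = IsPartialOrder.trans G.isPartialOrder
          (crossed (C.+-mono-≤ r≲ (0≤ˢ s)))
          (IsPartialOrder.reflexive G.isPartialOrder (G.sym (·-positive n (embed 1#))))
    in n , proj₂ (proj₂ (G.supremum (p , q) (q , p))) _
        (below (P.trans (≲bound k x) (×-mono-≤ (embed 1#) (ℕ.m≤m+n (bound k) (bound l)))))
        (below (P.trans (≲bound l y) (×-mono-≤ (embed 1#) (ℕ.m≤n+m (bound l) (bound k))))) }

  unitalVectorLattice : UnitalQVectorLattice c ℓ
  unitalVectorLattice = record
    { vectorLattice = vectorLattice
    ; u             = unit
    ; isStrongUnit  = isStrongUnit
    }

-- Functoriality of the enveloping lattice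

module EnvelopingMap {c ℓ c′ ℓ′ : Level} {A : DMVAlgebra c ℓ} {B : DMVAlgebra c′ ℓ′}
                     (f : DMVHomomorphism A B) where
  open DMVHomomorphism f
  private
    module A where
      open DMVAlgebra A public
      open EnvelopingLattice A public
      open LatticeCone cone public using () renaming (_+_ to _+ˢ_)
    module B where
      open DMVAlgebra B public
      open EnvelopingLattice B public
      open LatticeCone cone public using () renaming (_+_ to _+ˢ_)
    module AV = UnitalQVectorLattice A.unitalVectorLattice
    module BV = UnitalQVectorLattice B.unitalVectorLattice
    module Cone = LatticeCone B.cone
    module D = Differences B.cone

  ⟦1⟧ : ⟦ A.1# ⟧ B.≈ B.1#
  ⟦1⟧ = B.trans (*-homo A.0#) (B.*-cong 0-homo)

  ⟦⟧-mono : ∀ {x y} → x A.≤ y → ⟦ x ⟧ B.≤ ⟦ y ⟧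
  ⟦⟧-mono {x} {y} x≤y = B.trans (B.∙-congʳ (B.sym (*-homo x)))
    (B.trans (B.sym (⊕-homo (x A.*) y)) (B.trans (⟦⟧-cong x≤y) ⟦1⟧))

  ∨-homo : ∀ x y → ⟦ x A.∨ y ⟧ B.≈ ⟦ x ⟧ B.∨ ⟦ y ⟧
  ∨-homo x y = B.trans (⊕-homo _ _) (B.∙-congʳ (B.trans (*-homo _) (B.*-cong
    (B.trans (⊕-homo _ _) (B.∙-congʳ (*-homo x))))))

  halve-homo : ∀ k x → ⟦ A.halve k x ⟧ B.≈ B.halve k ⟦ x ⟧
  halve-homo zero    x = B.refl
  halve-homo (suc k) x = B.trans (δ-homo 2 _) (B.half-cong (halve-homo k x))

  mapˢ : A.Scaled → B.Scaled
  mapˢ (k , x) = k , ⟦ x ⟧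

  mapˢ-mono : ∀ {p q} → p A.≲ q → mapˢ p B.≲ mapˢ q
  mapˢ-mono {k , x} {l , y} (A.scaled p) =
    B.scaled (B.≤-resp-≈ (halve-homo l x) (halve-homo k y) (⟦⟧-mono p))

  mapˢ-+ : ∀ p q → mapˢ (p A.+ˢ q) B.≋ mapˢ p B.+ˢ mapˢ q
  mapˢ-+ (k , x) (l , y) = B.≋-cong ≡.refl
    (B.trans (⊕-homo _ _) (B.⊕-cong (halve-homo (suc l) x) (halve-homo (suc k) y)))

  mapˢ-⊔ : ∀ p q → mapˢ (p A.⊔ˢ q) B.≋ mapˢ p B.⊔ˢ mapˢ q
  mapˢ-⊔ (k , x) (l , y) = B.≋-cong ≡.refl
    (B.trans (∨-homo _ _) (B.∨-cong (halve-homo l x) (halve-homo k y)))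

  mapᵈ : A.Difference → B.Difference
  mapᵈ (p , q) = mapˢ p , mapˢ q

  mapᵈ-mono : ∀ {p q} → p A.≼ q → mapᵈ p B.≼ mapᵈ q
  mapᵈ-mono {a , b} {c , d} (A.crossed p) =
    B.crossed (D.≤-resp-≈ (mapˢ-+ a d) (mapˢ-+ c b) (mapˢ-mono p))

  mapᵈ-cong : ∀ {p q} → p AV.≈ᴹ q → mapᵈ p BV.≈ᴹ mapᵈ q
  mapᵈ-cong (p≼q , q≼p) = mapᵈ-mono p≼q , mapᵈ-mono q≼p

  mapᵈ-∨ : ∀ p q → mapᵈ (p AV.∨ q) BV.≈ᴹ mapᵈ p BV.∨ mapᵈ q
  mapᵈ-∨ (a , b) (c , d) = D.≋-cong
    (Cone.trans (mapˢ-⊔ (a A.+ˢ d) (c A.+ˢ b)) (⊔-cong (mapˢ-+ a d) (mapˢ-+ c b)))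
    (mapˢ-+ b d)
    where open JoinProperties D.joinSemilattice using () renaming (∨-cong to ⊔-cong)

  envelopingHomomorphism :
    UnitalQVectorLatticeHomomorphism A.unitalVectorLattice B.unitalVectorLattice
  envelopingHomomorphism = record
    { ⟦_⟧ = mapᵈ
    ; isLeftModuleHomomorphism = additive⇒linear A.unitalVectorLattice B.unitalVectorLattice
        mapᵈ mapᵈ-cong (λ (a , b) (c , d) → D.≋-cong (mapˢ-+ a c) (mapˢ-+ b d))
    ; ∨-homo = mapᵈ-∨
    -- Meets are negated joins of negatives, and negation swaps components, which `mapᵈ` respects
    -- definitionally.
    ; ∧-homo = λ p q → BV.-ᴹ‿cong (mapᵈ-∨ (AV.-ᴹ p) (AV.-ᴹ q))
    ; u-homo = D.≋-cong (B.≋-cong ≡.refl ⟦1⟧) (B.≋-cong ≡.refl 0-homo)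
    }

-- Unit and counit

module UnitIsomorphism {c ℓ : Level} (V : UnitalQVectorLattice c ℓ) where
  open UnitalQVectorLattice V
  open UnitInterval V hiding (mvAlgebra)
  open [0,u]
  open VectorLatticeProperties V
  open IsLattice isLattice using (antisym; x≤x∨y; y≤x∨y; x∧y≤x; x∧y≤y; ∧-greatest)
    renaming (refl to ≤-refl; trans to ≤-trans; reflexive to ≤-reflexive)
  open AbelianGroupProperties +ᴹ-abelianGroup using (⁻¹-∙-comm; ε⁻¹≈ε)
  open CommutativeSemigroupProperties (CommutativeMonoid.commutativeSemigroup +ᴹ-commutativeMonoid)
    using (interchange)
  open SetoidReasoning ≈ᴹ-setoid
  private
    module E = EnvelopingLattice dmvAlgebra
    module EV = UnitalQVectorLattice E.unitalVectorLattice
    module Cone = LatticeCone E.cone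

  u-0≈u : u -ᴹ 0ᴹ ≈ᴹ u
  u-0≈u = ≈ᴹ-trans (+ᴹ-congˡ ε⁻¹≈ε) (+ᴹ-identityʳ u)

  mv-≤⇒≤ : ∀ {x y} → x E.≤ y → val x ≤ val y
  mv-≤⇒≤ {x} {y} p = +ᴹ-cancelʳ-≤ u (≤-≈-≈ (+ᴹ-comm _ _)
    (≈ᴹ-trans ([x-z+y]+z≈x+y u (val y) (val x)) (+ᴹ-comm _ _))
    (+ᴹ-monoˡ-≤ (val x) u≤))
    where
    u≤ : u ≤ (u -ᴹ val x) +ᴹ val y
    u≤ = ≤-trans (≤-reflexive (≈ᴹ-trans (≈ᴹ-sym u-0≈u) (≈ᴹ-sym p))) (x∧y≤y _ _)

  ≤⇒mv-≤ : ∀ {x y} → val x ≤ val y → x E.≤ y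
  ≤⇒mv-≤ {x} {y} p = ≈ᴹ-trans (antisym (x∧y≤x _ _) (∧-greatest ≤-refl u≤)) (≈ᴹ-sym u-0≈u)
    where
    u≤ : u ≤ (u -ᴹ val x) +ᴹ val y
    u≤ = ≤-≈-≈ (x-z+z≈x u (val x)) ≈ᴹ-refl (+ᴹ-monoʳ-≤ (u -ᴹ val x) p)

  ⊥⇒val-⊕ : ∀ {x y} → x E.⊥ y → val (x ⊕ y) ≈ᴹ val x +ᴹ val y
  ⊥⇒val-⊕ {x} {y} p = x≤y⇒y∧x≈x
    (≤-≈-≈ ≈ᴹ-refl (x-z+z≈x u (val y)) (+ᴹ-monoˡ-≤ (val y) (mv-≤⇒≤ {x} {y *} p)))

  doubled : ℕ → Carrierᴹ → Carrierᴹ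
  doubled zero    v = v
  doubled (suc k) v = doubled k v +ᴹ doubled k v

  doubled-mono : ∀ k {v w} → v ≤ w → doubled k v ≤ doubled k w
  doubled-mono zero    p = p
  doubled-mono (suc k) p = +ᴹ-mono-≤ (doubled-mono k p) (doubled-mono k p)

  doubled-cong : ∀ k {v w} → v ≈ᴹ w → doubled k v ≈ᴹ doubled k w
  doubled-cong zero    p = p
  doubled-cong (suc k) p = +ᴹ-cong (doubled-cong k p) (doubled-cong k p)

  doubled-cancel-≤ : ∀ k {v w} → doubled k v ≤ doubled k w → v ≤ w
  doubled-cancel-≤ zero    p = p
  doubled-cancel-≤ (suc k) p = doubled-cancel-≤ k (×-cancel-≤ 1
    (≤-≈-≈ (+ᴹ-congˡ (≈ᴹ-sym (+ᴹ-identityʳ _))) (+ᴹ-congˡ (≈ᴹ-sym (+ᴹ-identityʳ _))) p))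

  doubled-+ : ∀ k v w → doubled k (v +ᴹ w) ≈ᴹ doubled k v +ᴹ doubled k w
  doubled-+ zero    v w = ≈ᴹ-refl
  doubled-+ (suc k) v w =
    ≈ᴹ-trans (+ᴹ-cong (doubled-+ k v w) (doubled-+ k v w)) (interchange _ _ _ _)

  doubled-0 : ∀ k → doubled k 0ᴹ ≈ᴹ 0ᴹ
  doubled-0 zero    = ≈ᴹ-refl
  doubled-0 (suc k) = ≈ᴹ-trans (+ᴹ-cong (doubled-0 k) (doubled-0 k)) (+ᴹ-identityʳ 0ᴹ)

  doubled-doubled : ∀ k l v → doubled (k ℕ.+ l) v ≈ᴹ doubled k (doubled l v)
  doubled-doubled zero    l v = ≈ᴹ-refl
  doubled-doubled (suc k) l v = +ᴹ-cong (doubled-doubled k l v) (doubled-doubled k l v)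

  doubled-exp : ∀ k l {n} v → n ≡ k ℕ.+ l → doubled n v ≈ᴹ doubled k (doubled l v)
  doubled-exp k l v ≡.refl = doubled-doubled k l v

  doubled-half : ∀ k v → doubled (suc k) ((+ 1 / 2) *ₗ v) ≈ᴹ doubled k v
  doubled-half k v = ≈ᴹ-trans (≈ᴹ-sym (doubled-+ k _ _))
    (doubled-cong k (≈ᴹ-trans (+ᴹ-congˡ (≈ᴹ-sym (+ᴹ-identityʳ _))) (n·x/n≈x 2 v)))

  doubled-halve : ∀ k x → doubled k (val (E.halve k x)) ≈ᴹ val x
  doubled-halve zero    x = ≈ᴹ-refl
  doubled-halve (suc k) x = ≈ᴹ-trans (doubled-half k (val (E.halve k x))) (doubled-halve k x)

  evalˢ : E.Scaled → Carrierᴹ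
  evalˢ (k , x) = doubled k (val x)

  private
    evalˢ-common : ∀ k l x → doubled k (doubled l (val (E.halve l x))) ≈ᴹ evalˢ (k , x)
    evalˢ-common k l x = doubled-cong k (doubled-halve l x)

    evalˢ-common′ : ∀ k l y → doubled k (doubled l (val (E.halve k y))) ≈ᴹ evalˢ (l , y)
    evalˢ-common′ k l y = ≈ᴹ-trans (≈ᴹ-trans (≈ᴹ-sym (doubled-doubled k l _))
      (doubled-exp l k _ (ℕ.+-comm k l))) (evalˢ-common l k y)

  evalˢ-mono : ∀ {p q} → p E.≲ q → evalˢ p ≤ evalˢ q
  evalˢ-mono {k , x} {l , y} (E.scaled p) =
    ≤-≈-≈ (evalˢ-common k l x) (evalˢ-common′ k l y) (doubled-mono k (doubled-mono l
      (mv-≤⇒≤ {E.halve l x} {E.halve k y} p)))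

  evalˢ-cancel : ∀ {p q} → evalˢ p ≤ evalˢ q → p E.≲ q
  evalˢ-cancel {k , x} {l , y} p =
    E.scaled (≤⇒mv-≤ {E.halve l x} {E.halve k y} (doubled-cancel-≤ l (doubled-cancel-≤ k
      (≤-≈-≈ (≈ᴹ-sym (evalˢ-common k l x)) (≈ᴹ-sym (evalˢ-common′ k l y)) p))))

  evalˢ-+ : ∀ p q → evalˢ (p Cone.+ q) ≈ᴹ evalˢ p +ᴹ evalˢ q
  evalˢ-+ (k , x) (l , y) = begin
    doubled n (val (E.halve (suc l) x ⊕ E.halve (suc k) y))
      ≈⟨ doubled-cong n (⊥⇒val-⊕ {E.halve (suc l) x} {E.halve (suc k) y}
           (E.half-⊥ (E.halve l x) (E.halve k y))) ⟩
    doubled n (val (E.halve (suc l) x) +ᴹ val (E.halve (suc k) y))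
      ≈⟨ doubled-+ n _ _ ⟩
    doubled n (val (E.halve (suc l) x)) +ᴹ doubled n (val (E.halve (suc k) y))
      ≈⟨ +ᴹ-cong (doubled-exp k (suc l) _ (≡.sym (ℕ.+-suc k l)))
                 (doubled-exp l (suc k) _ (≡.trans (≡.cong suc (ℕ.+-comm k l)) (≡.sym (ℕ.+-suc l k)))) ⟩
    doubled k (doubled (suc l) (val (E.halve (suc l) x))) +ᴹ
    doubled l (doubled (suc k) (val (E.halve (suc k) y)))
      ≈⟨ +ᴹ-cong (evalˢ-common k (suc l) x) (evalˢ-common l (suc k) y) ⟩
    doubled k (val x) +ᴹ doubled l (val y)
      ∎
    where n = suc (k ℕ.+ l)

  eval : E.Difference → Carrierᴹ
  eval (p , q) = evalˢ p -ᴹ evalˢ q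

  private
    [x-y]+[z+y]≈x+z : ∀ x y z → (x -ᴹ y) +ᴹ (z +ᴹ y) ≈ᴹ x +ᴹ z
    [x-y]+[z+y]≈x+z x y z = ≈ᴹ-trans (≈ᴹ-sym (+ᴹ-assoc _ z y)) ([x-z+y]+z≈x+y x z y)

    -- Adding s + q to both sides of p - q ≤ r - s yields the cross sums that define the order on
    -- differences; this is the left side and `cross′` the right.
    cross : ∀ p q s → eval (p , q) +ᴹ (evalˢ s +ᴹ evalˢ q) ≈ᴹ evalˢ (p Cone.+ s)
    cross p q s = ≈ᴹ-trans ([x-y]+[z+y]≈x+z _ _ _) (≈ᴹ-sym (evalˢ-+ p s))

    cross′ : ∀ q r s → eval (r , s) +ᴹ (evalˢ s +ᴹ evalˢ q) ≈ᴹ evalˢ (r Cone.+ q)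
    cross′ q r s = ≈ᴹ-trans (+ᴹ-congˡ (+ᴹ-comm _ _)) (cross r s q)

  eval-mono : ∀ {p q} → p EV.≤ q → eval p ≤ eval q
  eval-mono {p , q} {r , s} (E.crossed t) = +ᴹ-cancelʳ-≤ (evalˢ s +ᴹ evalˢ q)
    (≤-≈-≈ (≈ᴹ-sym (cross p q s)) (≈ᴹ-sym (cross′ q r s)) (evalˢ-mono t))

  eval-cancel : ∀ {p q} → eval p ≤ eval q → p EV.≤ q
  eval-cancel {p , q} {r , s} t = E.crossed (evalˢ-cancel
    (≤-≈-≈ (cross p q s) (cross′ q r s) (+ᴹ-monoˡ-≤ (evalˢ s +ᴹ evalˢ q) t)))

  eval-+ : ∀ p q → eval (p EV.+ᴹ q) ≈ᴹ eval p +ᴹ eval q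
  eval-+ (p , q) (r , s) = ≈ᴹ-trans
    (+ᴹ-cong (evalˢ-+ p r) (≈ᴹ-trans (-ᴹ‿cong (evalˢ-+ q s)) (≈ᴹ-sym (⁻¹-∙-comm _ _))))
    (interchange _ _ _ _)

  halved : ℕ → Carrierᴹ → Carrierᴹ
  halved zero    v = v
  halved (suc k) v = (+ 1 / 2) *ₗ halved k v

  doubled-halved : ∀ k v → doubled k (halved k v) ≈ᴹ v
  doubled-halved zero    v = ≈ᴹ-refl
  doubled-halved (suc k) v = ≈ᴹ-trans (doubled-half k (halved k v)) (doubled-halved k v)

  toScaled : ∀ k v → 0ᴹ ≤ v → v ≤ doubled k u → E.Scaled
  toScaled k v 0≤v v≤ = k , interval (halved k v)
    (doubled-cancel-≤ k (≤-≈-≈ (≈ᴹ-sym (doubled-0 k)) (≈ᴹ-sym (doubled-halved k v)) 0≤v))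
    (doubled-cancel-≤ k (≤-≈-≈ (≈ᴹ-sym (doubled-halved k v)) ≈ᴹ-refl v≤))

  x≤y+x : ∀ {x y} → 0ᴹ ≤ y → x ≤ y +ᴹ x
  x≤y+x {x} p = ≤-≈-≈ (+ᴹ-identityˡ x) ≈ᴹ-refl (+ᴹ-monoˡ-≤ x p)

  0≤doubled-u : ∀ k → 0ᴹ ≤ doubled k u
  0≤doubled-u k = ≤-≈-≈ (doubled-0 k) ≈ᴹ-refl (doubled-mono k 0≤u)

  u≤doubled-u : ∀ k → u ≤ doubled k u
  u≤doubled-u zero    = ≤-refl
  u≤doubled-u (suc k) = ≤-trans (u≤doubled-u k) (x≤y+x (0≤doubled-u k))

  -- This is n ≤ 2ⁿ. It lets the bound supplied by the strong unit serve as the exponent of the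
  -- scale.
  n·u≤doubled-u : ∀ n → n ·ᴹ u ≤ doubled n u
  n·u≤doubled-u zero    = 0≤u
  n·u≤doubled-u (suc n) = +ᴹ-mono-≤ (u≤doubled-u n) (n·u≤doubled-u n)

  0≤n·u : ∀ n → 0ᴹ ≤ n ·ᴹ u
  0≤n·u zero    = ≤-refl
  0≤n·u (suc n) = ≤-trans (0≤n·u n) (x≤y+x 0≤u)

  -- If |v| ≤ n u then both v + n u and n u lie in [0, 2ⁿ⁺¹ u].
  toDifference : Carrierᴹ → E.Difference
  toDifference v with n , ∣v∣≤nu ← proj₂ isStrongUnit v =
    toScaled (suc n) (v +ᴹ n ·ᴹ u)
      (≤-≈-≈ (-ᴹ‿inverseʳ v) ≈ᴹ-refl (+ᴹ-monoʳ-≤ v (≤-trans (y≤x∨y _ _) ∣v∣≤nu)))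
      (+ᴹ-mono-≤ (≤-trans (≤-trans (x≤x∨y _ _) ∣v∣≤nu) (n·u≤doubled-u n)) (n·u≤doubled-u n)) ,
    toScaled n (n ·ᴹ u) (0≤n·u n) (n·u≤doubled-u n)

  eval-toDifference : ∀ v → eval (toDifference v) ≈ᴹ v
  eval-toDifference v with n , ∣v∣≤nu ← proj₂ isStrongUnit v = ≈ᴹ-trans
    (+ᴹ-cong (doubled-halved (suc n) _) (-ᴹ‿cong (doubled-halved n _))) (x+z-z≈x v _)

  isomorphism : UnitalOrderIsomorphism E.unitalVectorLattice V
  isomorphism = record
    { to      = eval
    ; from    = toDifference
    ; to-≤    = eval-mono
    ; to-≤⁻¹  = eval-cancel
    ; to-from = eval-toDifference
    ; to-+    = eval-+
    ; to-u    = ≈ᴹ-trans (+ᴹ-congʳ u-0≈u) u-0≈u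
    }

module _ {c ℓ c′ ℓ′ : Level} {A : DMVAlgebra c ℓ} {B : DMVAlgebra c′ ℓ′}
         (f : DMVHomomorphism A B) where
  private
    module A = DMVAlgebra A
    module B = DMVAlgebra B
  open DMVHomomorphism f

  inverseHomomorphism : (g : B.Carrier → A.Carrier) →
    (∀ {x y} → ⟦ x ⟧ B.≈ ⟦ y ⟧ → x A.≈ y) → (∀ y → ⟦ g y ⟧ B.≈ y) → DMVHomomorphism B A
  inverseHomomorphism g injective section = record
    { ⟦_⟧ = g
    ; ⊕-isMonoidHomomorphism = record
      { isMagmaHomomorphism = record
        { isRelHomomorphism = record
          { cong = λ x≈y → injective (B.trans (section _) (B.trans x≈y (B.sym (section _)))) }
        ; homo = λ x y → injective (B.trans (section _)
            (B.sym (B.trans (⊕-homo _ _) (B.⊕-cong (section x) (section y)))))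
        }
      ; ε-homo = injective (B.trans (section _) (B.sym 0-homo))
      }
    ; *-homo = λ x → injective (B.trans (section _)
        (B.sym (B.trans (*-homo _) (B.*-cong (section x)))))
    ; δ-homo = λ n x → injective (B.trans (section _)
        (B.sym (B.trans (δ-homo n _) (B.δ-cong n (section x)))))
    }

-- A DMV-algebra as the unit interval of its enveloping lattice

module CounitBijection {c ℓ : Level} (A : DMVAlgebra c ℓ) where
  open DMVAlgebra A
  open EnvelopingLattice A
  open UnitalQVectorLattice unitalVectorLattice
    using (Carrierᴹ; _≈ᴹ_; _+ᴹ_; _·ᴹ_; u; ≈ᴹ-refl; ≈ᴹ-sym; ≈ᴹ-trans; +ᴹ-congʳ; +ᴹ-monoˡ-≤)
    renaming (_≤_ to _≤ᴹ_; isLattice to isLatticeᴹ)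
  open VectorLatticeProperties unitalVectorLattice using (×-cancel)
  open IsLattice isLatticeᴹ using (antisym)
    renaming (trans to ≤ᴹ-trans; reflexive to ≤ᴹ-reflexive; ∧-greatest to ∧ᴹ-greatest;
              x∧y≤y to x∧ᴹy≤y)
  private
    module I = UnitInterval unitalVectorLattice
    module Cone = LatticeCone cone
    module D = Differences cone
    module B = DMVAlgebra I.dmvAlgebra
  open I.[0,u] using (val)

  undouble : ℕ → Carrier → Carrier
  undouble zero    x = x
  undouble (suc k) x = undouble k (double x)

  -- Below 1/2ᵏ none of the k doublings truncates, and uniqueness of halves reverses them one at a
  -- time.
  halve-undouble : ∀ k {x} → x ≤ halve k 1# → halve k (undouble k x) ≈ x
  halve-undouble zero    p = refl
  halve-undouble (suc k) {x} p = trans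
    (half-cong (halve-undouble k (≤-resp-≈ refl (double-half _) (double-mono p))))
    (sym (half-unique (≤-trans p (half≤½ _)) refl))

  embedᴹ : Carrier → Carrierᴹ
  embedᴹ x = positive (embed x)

  embedᴹ-mono : ∀ {x y} → x ≤ y → embedᴹ x ≤ᴹ embedᴹ y
  embedᴹ-mono p = positive-mono (scaled p)

  embedᴹ-cancel : ∀ {x y} → embedᴹ x ≤ᴹ embedᴹ y → x ≤ y
  embedᴹ-cancel p = unscaled (positive-cancel p)

  embedᴹ-⊕ : ∀ {x y} → x ⊥ y → embedᴹ (x ⊕ y) ≈ᴹ embedᴹ x +ᴹ embedᴹ y
  embedᴹ-⊕ {x} {y} p = ≈ᴹ-trans (positive-cong (Cone.sym (+-same-scale 0 p)))
    (positive-+ (embed x) (embed y))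

  ι : Carrier → I.[0,u]
  ι x = I.interval (embedᴹ x) (embedᴹ-mono (0≤ x)) (embedᴹ-mono (≤1 x))

  ι-cong : ∀ {x y} → x ≈ y → ι x B.≈ ι y
  ι-cong e = positive-cong (≋-cong ≡.refl e)

  ι-injective : ∀ {x y} → ι x B.≈ ι y → x ≈ y
  ι-injective p = ≤-antisym
    (embedᴹ-cancel (≤ᴹ-reflexive p)) (embedᴹ-cancel (≤ᴹ-reflexive (≈ᴹ-sym p)))

  -- Positivity of p - q allows the subtraction in the cone and leaves a single pair r. The upper
  -- bound says that the second component of r is at most 1/2ᵏ, so that its k-fold doubling is an
  -- element of A with the value of r.
  ι-surjective : ∀ y → ∃ λ x → ι x B.≈ y
  ι-surjective (I.interval (p , q) 0≤y y≤u) =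
    let q≲p       = from-0+ (D.uncrossed 0≤y)
        r , r+q≋p = Cone.subtract q≲p
        r≈y       = positive-difference r+q≋p
    in undouble (proj₁ r) (proj₂ r) ,
       ≈ᴹ-trans
         (positive-cong (≋-intro (halve-undouble (proj₁ r)
           (unscaled (positive-cancel {r} (≤ᴹ-trans (≤ᴹ-reflexive r≈y) y≤u))))))
         r≈y
    where
    from-0+ : 0ˢ Cone.+ q ≲ p Cone.+ 0ˢ → q ≲ p
    from-0+ = D.≤-resp-≈ (Cone.identityˡ q) (Cone.identityʳ p)

    positive-difference : ∀ {r} → r Cone.+ q ≋ p → positive r ≈ᴹ (p , q)
    positive-difference {r} e = D.crossed (IsPartialOrder.reflexive isPartialOrder eq) ,
                             D.crossed (IsPartialOrder.reflexive isPartialOrder (Cone.sym eq))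
      where
      eq : r Cone.+ q ≋ p Cone.+ 0ˢ
      eq = Cone.trans e (Cone.sym (Cone.identityʳ p))

  -- The truncated sum is an untruncated one of (x ⊕ y) ⊖ y and y, and the first of these is at most
  -- x.
  embedᴹ-⊕-≤ : ∀ x y → embedᴹ (x ⊕ y) ≤ᴹ embedᴹ x +ᴹ embedᴹ y
  embedᴹ-⊕-≤ x y = ≤ᴹ-trans (≤ᴹ-reflexive (≈ᴹ-trans (ι-cong (sym z⊕y≈x⊕y)) (embedᴹ-⊕ (⊖-⊥ _ _))))
    (+ᴹ-monoˡ-≤ (embedᴹ y) (embedᴹ-mono (⊖-adjointʳ (≤-reflexive (comm x y)))))
    where
    z⊕y≈x⊕y : ((x ⊕ y) ⊖ y) ⊕ y ≈ x ⊕ y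
    z⊕y≈x⊕y = ⊖-⊕ (y≤x⊕y x y)

  -- For the inequality from right to left, surjectivity presents the truncated sum in the interval
  -- as the image of some z, so that the comparison takes place in A.
  ι-⊕ : ∀ x y → ι (x ⊕ y) B.≈ ι x B.⊕ ι y
  ι-⊕ x y = antisym
    (∧ᴹ-greatest (embedᴹ-mono (≤1 _)) (embedᴹ-⊕-≤ x y))
    below
    where
    z = proj₁ (ι-surjective (ι x B.⊕ ι y))
    ιz≈ = proj₂ (ι-surjective (ι x B.⊕ ι y))

    z≤x⊕y : z ≤ x ⊕ y
    -- The sum of the two embedded elements has scale 1, so the comparison reads
    -- `half z ≤ half x ⊕ half y` and only has to be doubled.
    z≤x⊕y = ≤-resp-≈ (double-half z) (trans (double-⊕ _ _) (⊕-cong (double-half x) (double-half y)))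
      (double-mono (unscaled (positive-cancel {embed z} {embed x Cone.+ embed y}
        (≤ᴹ-trans (≤ᴹ-reflexive ιz≈) (≤ᴹ-trans (x∧ᴹy≤y u (embedᴹ x +ᴹ embedᴹ y))
          (≤ᴹ-reflexive (≈ᴹ-sym (positive-+ (embed x) (embed y)))))))))

    below : val (ι x B.⊕ ι y) ≤ᴹ embedᴹ (x ⊕ y)
    below = ≤ᴹ-trans (≤ᴹ-reflexive (≈ᴹ-sym ιz≈)) (embedᴹ-mono z≤x⊕y)

  ι-* : ∀ x → ι (x *) B.≈ ι x B.*
  ι-* x = ≈ᴹ-trans (≈ᴹ-sym (I.x+z-z≈x _ (embedᴹ x))) (+ᴹ-congʳ (≈ᴹ-trans
    -- The first `≤-refl` proves `x * ⊥ x`; the second proves `x * ⊕ x ≈ 1#`, to which `x ≤ x`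
    -- unfolds.
    (≈ᴹ-sym (embedᴹ-⊕ ≤-refl)) (ι-cong ≤-refl)))

  -- Both sides have the same n-fold sum, namely the image of x, and the enveloping lattice is
  -- torsion-free.
  ι-δ : ∀ n .{{_ : ℕ.NonZero n}} x → ι (δ n x) B.≈ B.δ n (ι x)
  ι-δ (suc n) x = ×-cancel n (≈ᴹ-trans n·ιδx≈ιx (≈ᴹ-sym (I.n·x/n≈x (suc n) (embedᴹ x))))
    where
    n·ιδx≈ιx : suc n ·ᴹ embedᴹ (δ (suc n) x) ≈ᴹ embedᴹ x
    n·ιδx≈ιx = ≈ᴹ-trans (·-positive (suc n) (embed (δ (suc n) x))) (positive-cong (×-divide n (embed x)))

  ι-homomorphism : DMVHomomorphism A I.dmvAlgebra
  ι-homomorphism = record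
    { ⟦_⟧ = ι
    ; ⊕-isMonoidHomomorphism = record
      { isMagmaHomomorphism = record
        { isRelHomomorphism = record { cong = ι-cong }
        ; homo = ι-⊕
        }
      ; ε-homo = ≈ᴹ-refl
      }
    ; *-homo = ι-*
    ; δ-homo = ι-δ
    }

  τ : I.[0,u] → Carrier
  τ y = proj₁ (ι-surjective y)

  ι-τ : ∀ y → ι (τ y) B.≈ y
  ι-τ y = proj₂ (ι-surjective y)

  τ-ι : ∀ x → τ (ι x) ≈ x
  τ-ι x = ι-injective (ι-τ (ι x))

  τ-homomorphism : DMVHomomorphism I.dmvAlgebra A
  τ-homomorphism = inverseHomomorphism ι-homomorphism τ ι-injective ι-τ

-- Naturality of the unit and the counit

module _ {c ℓ c′ ℓ′ : Level} {V : UnitalQVectorLattice c ℓ} {W : UnitalQVectorLattice c′ ℓ′}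
         (f : UnitalQVectorLatticeHomomorphism V W) where
  open UnitalQVectorLatticeHomomorphism f
  private
    module V where
      open UnitIsomorphism V public
      open UnitalOrderIsomorphism isomorphism public
    module W where
      open UnitalQVectorLattice W public
      open UnitIsomorphism W public
      open UnitalOrderIsomorphism isomorphism public
    module EW = UnitalQVectorLattice
                  (EnvelopingLattice.unitalVectorLattice (UnitInterval.dmvAlgebra W))
    module F = EnvelopingMap (restrictHomomorphism f)

  doubled-natural : ∀ k x → W.doubled k ⟦ x ⟧ W.≈ᴹ ⟦ V.doubled k x ⟧
  doubled-natural zero    x = W.≈ᴹ-refl
  doubled-natural (suc k) x = W.≈ᴹ-trans
    (W.+ᴹ-cong (doubled-natural k x) (doubled-natural k x)) (W.≈ᴹ-sym (+ᴹ-homo _ _))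

  eval-natural : ∀ p → W.eval (F.mapᵈ p) W.≈ᴹ ⟦ V.eval p ⟧
  eval-natural ((k , x) , (l , y)) = W.≈ᴹ-trans
    (W.+ᴹ-cong (doubled-natural k _)
      (W.≈ᴹ-trans (W.-ᴹ‿cong (doubled-natural l _)) (W.≈ᴹ-sym (-ᴹ-homo _))))
    (W.≈ᴹ-sym (+ᴹ-homo _ _))

  -- The bounds chosen for v and for its image need not agree, so the two differences are compared
  -- through their values, `eval` being injective.
  toDifference-natural : ∀ v → W.toDifference ⟦ v ⟧ EW.≈ᴹ F.mapᵈ (V.toDifference v)
  toDifference-natural v = W.to-injective {W.toDifference ⟦ v ⟧} {F.mapᵈ (V.toDifference v)}
    (W.≈ᴹ-trans (W.to-from ⟦ v ⟧)
      (W.≈ᴹ-sym (W.≈ᴹ-trans (eval-natural (V.toDifference v)) (⟦⟧-cong (V.to-from v)))))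

module _ {c ℓ c′ ℓ′ : Level} {A : DMVAlgebra c ℓ} {B : DMVAlgebra c′ ℓ′}
         (f : DMVHomomorphism A B) where
  open DMVHomomorphism f
  private
    module A = CounitBijection A
    module B where
      open DMVAlgebra B public
      open EnvelopingLattice B public using (unitalVectorLattice; ≋-cong; cone)
      open UnitalQVectorLattice unitalVectorLattice public using (≈ᴹ-trans; ≈ᴹ-sym)
      open CounitBijection B public
    module F = EnvelopingMap f

  τ-natural : ∀ y → B.τ (restrict F.envelopingHomomorphism y) B.≈ ⟦ A.τ y ⟧
  τ-natural y = B.ι-injective (B.≈ᴹ-trans
    (B.ι-τ (restrict F.envelopingHomomorphism y)) (B.≈ᴹ-sym (B.≈ᴹ-trans
    -- An embedded element has subtrahend `(0 , 0#)`, which `mapᵈ` turns into the image of `0#`.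
    (Differences.≋-cong B.cone (LatticeCone.refl B.cone) (B.≋-cong ≡.refl (B.sym 0-homo)))
    (F.mapᵈ-cong (A.ι-τ y)))))

-- Abstracting from the object map keeps its construction folded while the laws are compared.
record Envelopes : Setω where
  field
    envelope  : ∀ {c ℓ} → DMVAlgebra c ℓ → UnitalQVectorLattice c ℓ
    map       : ∀ {c ℓ c′ ℓ′} {A : DMVAlgebra c ℓ} {B : DMVAlgebra c′ ℓ′} →
                DMVHomomorphism A B → UnitalQVectorLatticeHomomorphism (envelope A) (envelope B)
    η         : ∀ {c ℓ} (V : UnitalQVectorLattice c ℓ) →
                UnitalOrderIsomorphism V (envelope (UnitInterval.dmvAlgebra V))
    ε         : ∀ {c ℓ} (A : DMVAlgebra c ℓ) →
                DMVHomomorphism (UnitInterval.dmvAlgebra (envelope A)) A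
    ε⁻¹       : ∀ {c ℓ} (A : DMVAlgebra c ℓ) →
                DMVHomomorphism A (UnitInterval.dmvAlgebra (envelope A))

  infix 4 _⊢_≈_
  infix 9 _$ᴰ_ _$ᵛ_

  _$ᴰ_ : ∀ {c ℓ c′ ℓ′} {A : DMVAlgebra c ℓ} {B : DMVAlgebra c′ ℓ′} →
         DMVHomomorphism A B → DMVAlgebra.Carrier A → DMVAlgebra.Carrier B
  _$ᴰ_ = DMVHomomorphism.⟦_⟧

  _$ᵛ_ : ∀ {c ℓ c′ ℓ′} {V : UnitalQVectorLattice c ℓ} {W : UnitalQVectorLattice c′ ℓ′} →
         UnitalQVectorLatticeHomomorphism V W →
         UnitalQVectorLattice.Carrierᴹ V → UnitalQVectorLattice.Carrierᴹ W
  _$ᵛ_ = UnitalQVectorLatticeHomomorphism.⟦_⟧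

  _⊢_≈_ : ∀ {c ℓ} (A : DMVAlgebra c ℓ) → Rel (UnitalQVectorLattice.Carrierᴹ (envelope A)) ℓ
  A ⊢ v ≈ w = UnitalQVectorLattice._≈ᴹ_ (envelope A) v w

  field
    map-resp  : ∀ {c ℓ c′ ℓ′} {A : DMVAlgebra c ℓ} {B : DMVAlgebra c′ ℓ′} {f g : DMVHomomorphism A B} →
                (∀ x → DMVAlgebra._≈_ B (f $ᴰ x) (g $ᴰ x)) →
                ∀ v → B ⊢ map f $ᵛ v ≈ map g $ᵛ v
    map-id    : ∀ {c ℓ} {A : DMVAlgebra c ℓ} v →
                A ⊢ map (Category.id (DMV c ℓ) {A}) $ᵛ v ≈ v
    map-∘     : ∀ {c ℓ} {A B C : DMVAlgebra c ℓ} {f : DMVHomomorphism A B} {g : DMVHomomorphism B C} v →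
                C ⊢ map (Category._∘_ (DMV c ℓ) {A} {B} {C} g f) $ᵛ v ≈ map g $ᵛ (map f $ᵛ v)
    η-natural : ∀ {c ℓ c′ ℓ′} {V : UnitalQVectorLattice c ℓ} {W : UnitalQVectorLattice c′ ℓ′}
                (f : UnitalQVectorLatticeHomomorphism V W) v →
                UnitInterval.dmvAlgebra W ⊢ UnitalOrderIsomorphism.to (η W) (f $ᵛ v) ≈
                  map (restrictHomomorphism f) $ᵛ UnitalOrderIsomorphism.to (η V) v
    ε-natural : ∀ {c ℓ c′ ℓ′} {A : DMVAlgebra c ℓ} {B : DMVAlgebra c′ ℓ′} (f : DMVHomomorphism A B) y →
                DMVAlgebra._≈_ B (ε B $ᴰ restrict (map f) y) (f $ᴰ (ε A $ᴰ y))
    ε⁻¹-ε     : ∀ {c ℓ} (A : DMVAlgebra c ℓ) y →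
                DMVAlgebra._≈_ (UnitInterval.dmvAlgebra (envelope A)) (ε⁻¹ A $ᴰ (ε A $ᴰ y)) y
    ε-ε⁻¹     : ∀ {c ℓ} (A : DMVAlgebra c ℓ) x → DMVAlgebra._≈_ A (ε A $ᴰ (ε⁻¹ A $ᴰ x)) x

  isCategoricalEquivalence : ∀ c ℓ → IsCategoricalEquivalence (Γℚ c ℓ)
  isCategoricalEquivalence c ℓ = record
    { F⁻¹ = record
      { F₀           = envelope
      ; F₁           = map
      ; F-resp-≈     = λ {A} {B} {f} {g} → map-resp {A = A} {B} {f} {g}
      ; identity     = map-id
      ; homomorphism = λ {A} {B} {C} {f} {g} → map-∘ {A = A} {B} {C} {f} {g}
      }
    ; unit = record
      { η       = λ V → UnitalOrderIsomorphism.homomorphism (η V)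
      ; η⁻¹     = λ V → UnitalOrderIsomorphism.homomorphism (inverse (η V))
      ; natural = η-natural
      ; isoˡ    = λ V → UnitalOrderIsomorphism.from-to (η V)
      ; isoʳ    = λ V → UnitalOrderIsomorphism.to-from (η V)
      }
    ; counit = record
      { η       = ε
      ; η⁻¹     = ε⁻¹
      ; natural = ε-natural
      ; isoˡ    = ε⁻¹-ε
      ; isoʳ    = ε-ε⁻¹
      }
    }

envelopes : Envelopes
envelopes = record
  { envelope  = EnvelopingLattice.unitalVectorLattice
  ; map       = EnvelopingMap.envelopingHomomorphism
  ; η         = λ V → inverse (UnitIsomorphism.isomorphism V)
  ; ε         = τ-homomorphism
  ; ε⁻¹       = ι-homomorphism
  ; map-resp  = λ { {B = B} f≈g ((k , x) , (l , y)) → Differences.≋-cong (ScaledAlgebra.cone B)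
      (ScaledAlgebra.≋-cong B ≡.refl (f≈g x)) (ScaledAlgebra.≋-cong B ≡.refl (f≈g y)) }
  ; map-id    = λ {A = A} _ →
      UnitalQVectorLattice.≈ᴹ-refl (EnvelopingLattice.unitalVectorLattice A)
  ; map-∘     = λ {C = C} _ →
      UnitalQVectorLattice.≈ᴹ-refl (EnvelopingLattice.unitalVectorLattice C)
  ; η-natural = toDifference-natural
  ; ε-natural = τ-natural
  ; ε⁻¹-ε     = ι-τ
  ; ε-ε⁻¹     = τ-ι
  }
  where open CounitBijection using (ι-homomorphism; τ-homomorphism; ι-τ; τ-ι)

theorem2p1 : (c ℓ : Level) → IsCategoricalEquivalence (Γℚ c ℓ)
theorem2p1 = Envelopes.isCategoricalEquivalence envelopes
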